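{- Let $\alpha_k$ be defined by $\alpha_k=q^{6r^2-4r}$ if $k=3r-1$, $\alpha_k=q^{6r^2+4r}$ if $k=3r$, $\alpha_k=-q^{6r^2+8r+2}-q^{6r^2+4r}$ if $k=3r+1$. Then for every integer $p\ge1$, every positive integer $N$ and every primitive $N$th root of unity $q$, $$H_p^{(7)}(q)=q\sum_{k=0}^{N-1}(-1)^kq^{\binom{k+1}{2}+(p-1)(k^2+k)}\alpha_k.$$
   Context: $(a)_n=\prod_{k=1}^n(1-aq^{k-1})$, $\begin{bmatrix} n\\ k\end{bmatrix}=\frac{(q)_n}{(q)_{n-k}(q)_k}$. $H_p^{(7)}(q)=\sum_{n_p\ge\cdots\ge n_1\ge0}q^{ -n_p^2-n_p}(q^{n_p+1})_{n_p}\prod_{i=1}^{p-1}q^{n_i^2+n_i}\begin{bmatrix} n_{i+1}\\ n_i\end{bmatrix}$; at a root of unity only finitely many terms are nonzero. -}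

module Defs where

open import Level using (Level)
open import Data.Nat using (ℕ; zero; suc)
import Data.Nat as ℕ
open import Data.Nat.Combinatorics using (_C_)
open import Algebra.Bundles using (CommutativeRing)

module Hseries {c ℓ : Level} (R : CommutativeRing c ℓ) where
  open CommutativeRing R hiding (zero)

  pow : Carrier → ℕ → Carrier
  pow x zero = 1#
  pow x (suc n) = pow x n * x

  embed : ℕ → Carrier
  embed zero = 0#
  embed (suc n) = embed n + 1#

  sumTo : ℕ → (ℕ → Carrier) → Carrier
  sumTo zero f = f zero
  sumTo (suc M) f = sumTo M f + f (suc M)

  sumBelow : ℕ → (ℕ → Carrier) → Carrier
  sumBelow zero f = 0#
  sumBelow (suc n) f = sumBelow n f + f n

  sign : ℕ → Carrier → Carrier
  sign zero x = x
  sign (suc k) x = - sign k x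

  module _ (q : Carrier) where
    qpoch : Carrier → ℕ → Carrier
    qpoch a zero = 1#
    qpoch a (suc n) = qpoch a n * (1# - a * pow q n)

    -- Gaussian binomial coefficient [n over k] as a polynomial in q
    -- (q-Pascal recursion), evaluated at q
    qbin : ℕ → ℕ → Carrier
    qbin n zero = 1#
    qbin zero (suc k) = 0#
    qbin (suc n) (suc k) = qbin n k + pow q (suc k) * qbin n (suc k)

    -- F p m = Σ over chains m = n_p ≥ n_{p-1} ≥ ... ≥ n_1 ≥ 0 of
    --   ∏_{i=1}^{p-1} q^{n_i^2+n_i} [n_{i+1} over n_i]     (p ≥ 1; F 0 is junk)
    F : ℕ → ℕ → Carrier
    F zero m = 1#
    F (suc zero) m = 1#
    F (suc (suc j)) m = sumTo m (λ n → pow q (n ℕ.* n ℕ.+ n) * qbin m n * F (suc j) n)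

    -- H_p^{(7)}(q) with outer index n_p truncated at M;
    -- qinv is the inverse of q, so pow qinv e = q^{-e}
    H7 : (qinv : Carrier) → (p M : ℕ) → Carrier
    H7 qinv p M = sumTo M (λ m →
      pow qinv (m ℕ.* m ℕ.+ m) * qpoch (pow q (suc m)) m * F p m)

    alpha : ℕ → Carrier
    alpha k = go (k ℕ.% 3)
      where
        go : ℕ → Carrier
        go zero = pow q (6 ℕ.* (k ℕ./ 3) ℕ.* (k ℕ./ 3) ℕ.+ 4 ℕ.* (k ℕ./ 3))
        go (suc zero) =
          (- pow q (6 ℕ.* (k ℕ./ 3) ℕ.* (k ℕ./ 3) ℕ.+ 8 ℕ.* (k ℕ./ 3) ℕ.+ 2))
            - pow q (6 ℕ.* (k ℕ./ 3) ℕ.* (k ℕ./ 3) ℕ.+ 4 ℕ.* (k ℕ./ 3))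
        -- k = 3r-1 : q^{6r^2-4r}, r = (k+1)/3 ≥ 1
        go (suc (suc _)) =
          pow q (6 ℕ.* ((k ℕ.+ 1) ℕ./ 3) ℕ.* ((k ℕ.+ 1) ℕ./ 3) ℕ.∸ 4 ℕ.* ((k ℕ.+ 1) ℕ./ 3))

    RHS : (p N : ℕ) → Carrier
    RHS p N = q * sumBelow N (λ k →
      sign k (pow q ((suc k C 2) ℕ.+ (p ℕ.∸ 1) ℕ.* (k ℕ.* k ℕ.+ k)) * alpha k))

{-# OPTIONS --safe #-}
-- Write B m r = [2m, m-r] - q^(2r+1) [2m, m-r-1]. Iterating the Bailey lemma relative to a = q, from the
-- unit pair, gives
--   (q^(m+1))_m F_p(m) = Σ_r (-1)^r q^(C(r,2) + p(r²+r)) B m r,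
-- where divisions by (q)_k with k < N are harmless as long as 2m < N. For N ≤ 2m with m < N both sides vanish:
-- the left one has the factor 1 - q^N, the right one is antisymmetric under r ↔ N-1-r.
-- Interchanging the sums leaves U_r = Σ_{m<N} q^(-m²-m) [2m, m-r]. A telescoping identity in m gives
-- U_r = q^(2r+3) U_{r+3} up to boundary terms with upper index 2N, nearly all of which vanish, so q^(r²) U_r
-- is q times the (N-1-r)-th partial sum of the α_k. Reversing r ↦ N-1-r, under which
-- (-1)^r q^C(r+1,2) is invariant, produces the right-hand side.
module Submission where

open import Defs
open import Level using (Level; _⊔_)
open import Data.Nat using (ℕ; zero; suc; _≤_; _<_; z≤n; s≤s; _∸_)
import Data.Nat as ℕ
import Data.Nat.Properties as ℕₚ
open import Data.Nat.Combinatorics using (_C_; nCk+nC[k+1]≡[n+1]C[k+1]; nC1≡n)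
open import Data.Nat.Divisibility using (n∣m*n)
open import Data.Nat.DivMod using (_divMod_; result; [m+kn]%n≡m%n; +-distrib-/-∣ʳ; m*n/n≡m)
open import Data.Nat.Tactic.RingSolver using (solve-∀)
open import Data.Integer using (ℤ; +_; -[1+_])
import Data.Integer as ℤ
import Data.Integer.Properties as ℤₚ
import Data.Fin as Fin
import Data.Fin.Properties as Finₚ
open import Data.Maybe using (Maybe; just; nothing)
open import Data.Product using (_,_)
open import Data.Sum using (_⊎_; inj₁; inj₂)
open import Data.Empty using (⊥-elim)
open import Relation.Nullary using (¬_; yes; no)
open import Relation.Binary.Definitions using (tri<; tri≈; tri>)
open import Relation.Binary.PropositionalEquality as ≡ using (_≡_)
open import Algebra.Bundles using (CommutativeRing)
open import Algebra.Solver.Ring.AlmostCommutativeRing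
  using (_-Raw-AlmostCommutative⟶_; fromCommutativeRing)
import Algebra.Solver.Ring

-- Everything is computed in the ring at the root of unity itself, so a factor (q)_k can be
-- cancelled only where it is known to be nonzero; this is what forces the separate treatment of N ≤
-- 2m. The Bailey relation β_m = Σ α_r / ((q)_(m-r) (q²)_(m+r)) is therefore multiplied by (q)_(2m).
-- Its kernel becomes a difference of Gaussian binomials, which makes sense for every q, and the
-- factor (q^(m+1))_m of the series is exactly what the multiplication asks for. The period 3 of the
-- α_k has its origin in the telescoping identity, which links r to r + 3: in each block of three
-- consecutive α_k the sum is zero, so their partial sums satisfy a three-step recursion with a
-- single monomial as multiplier.

-- Integer coefficients for the ring solver

module IntegerCoefficients {c ℓ : Level} (R : CommutativeRing c ℓ) where
  open CommutativeRing R hiding (zero)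
  open import Algebra.Properties.Ring ring
  open import Algebra.Properties.AbelianGroup +-abelianGroup using (⁻¹-∙-comm)
  open import Algebra.Properties.CommutativeSemigroup +-commutativeSemigroup using (interchange)
  open import Algebra.Properties.Semiring.Mult.TCOptimised semiring
    using (×-homo-+; ×1-homo-*; 1+×) renaming (_×_ to _·_)
  open import Relation.Binary.Reasoning.Setoid setoid

  -- Equality in `R` is not decidable, so the solver compares coefficients in ℤ. With the optimised
  -- multiple, `1 · 1#` reduces to `1#`, so `con (+ 1)` matches `1#` definitionally.
  ⟦_⟧ : ℤ → Carrier
  ⟦ + n ⟧ = n · 1#
  ⟦ -[1+ n ] ⟧ = - (suc n · 1#)

  ⟦⊖⟧ : ∀ m n → ⟦ m ℤ.⊖ n ⟧ ≈ m · 1# - n · 1#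
  ⟦⊖⟧ m zero = sym (trans (+-congˡ -0#≈0#) (+-identityʳ _))
  ⟦⊖⟧ zero (suc n) = sym (+-identityˡ _)
  ⟦⊖⟧ (suc m) (suc n) = begin
    ⟦ suc m ℤ.⊖ suc n ⟧ ≡⟨ ≡.cong ⟦_⟧ (ℤₚ.[1+m]⊖[1+n]≡m⊖n m n) ⟩
    ⟦ m ℤ.⊖ n ⟧ ≈⟨ ⟦⊖⟧ m n ⟩
    m · 1# - n · 1# ≈⟨ +-identityˡ _ ⟨
    0# + (m · 1# - n · 1#) ≈⟨ +-congʳ (-‿inverseʳ 1#) ⟨
    (1# - 1#) + (m · 1# - n · 1#) ≈⟨ interchange _ _ _ _ ⟩
    (1# + m · 1#) + (- 1# - n · 1#) ≈⟨ +-cong (sym (1+× m 1#)) (trans (⁻¹-∙-comm _ _) (-‿cong (sym (1+× n 1#)))) ⟩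
    suc m · 1# - suc n · 1# ∎

  ⟦-⟧ : ∀ i → ⟦ ℤ.- i ⟧ ≈ - ⟦ i ⟧
  ⟦-⟧ (+ zero) = sym -0#≈0#
  ⟦-⟧ (+ suc n) = refl
  ⟦-⟧ -[1+ n ] = sym (-‿involutive _)

  ⟦+⟧ : ∀ i j → ⟦ i ℤ.+ j ⟧ ≈ ⟦ i ⟧ + ⟦ j ⟧
  ⟦+⟧ (+ m) (+ n) = ×-homo-+ 1# m n
  ⟦+⟧ (+ m) -[1+ n ] = ⟦⊖⟧ m (suc n)
  ⟦+⟧ -[1+ m ] (+ n) = trans (⟦⊖⟧ n (suc m)) (+-comm _ _)
  ⟦+⟧ -[1+ m ] -[1+ n ] = begin
    - (suc (suc (m ℕ.+ n)) · 1#) ≡⟨ ≡.cong (λ k → - (k · 1#)) (≡.sym (ℕₚ.+-suc (suc m) n)) ⟩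
    - ((suc m ℕ.+ suc n) · 1#) ≈⟨ -‿cong (×-homo-+ 1# (suc m) (suc n)) ⟩
    - (suc m · 1# + suc n · 1#) ≈⟨ ⁻¹-∙-comm _ _ ⟨
    - (suc m · 1#) - suc n · 1# ∎

  ⟦+*⟧ : ∀ m j → ⟦ + m ℤ.* j ⟧ ≈ m · 1# * ⟦ j ⟧
  ⟦+*⟧ m (+ n) = begin
    ⟦ + m ℤ.* + n ⟧ ≡⟨ ≡.cong ⟦_⟧ (≡.sym (ℤₚ.pos-* m n)) ⟩
    (m ℕ.* n) · 1# ≈⟨ ×1-homo-* m n ⟩
    m · 1# * n · 1# ∎
  ⟦+*⟧ m -[1+ n ] = begin
    ⟦ + m ℤ.* ℤ.- (+ suc n) ⟧ ≡⟨ ≡.cong ⟦_⟧ (≡.sym (ℤₚ.neg-distribʳ-* (+ m) (+ suc n))) ⟩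
    ⟦ ℤ.- (+ m ℤ.* + suc n) ⟧ ≈⟨ ⟦-⟧ (+ m ℤ.* + suc n) ⟩
    - ⟦ + m ℤ.* + suc n ⟧ ≈⟨ -‿cong (⟦+*⟧ m (+ suc n)) ⟩
    - (m · 1# * suc n · 1#) ≈⟨ -‿distribʳ-* _ _ ⟩
    m · 1# * - (suc n · 1#) ∎
  ⟦*⟧ : ∀ i j → ⟦ i ℤ.* j ⟧ ≈ ⟦ i ⟧ * ⟦ j ⟧
  ⟦*⟧ (+ m) j = ⟦+*⟧ m j
  ⟦*⟧ -[1+ m ] j = begin
    ⟦ ℤ.- (+ suc m) ℤ.* j ⟧ ≡⟨ ≡.cong ⟦_⟧ (≡.sym (ℤₚ.neg-distribˡ-* (+ suc m) j)) ⟩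
    ⟦ ℤ.- (+ suc m ℤ.* j) ⟧ ≈⟨ ⟦-⟧ (+ suc m ℤ.* j) ⟩
    - ⟦ + suc m ℤ.* j ⟧ ≈⟨ -‿cong (⟦+*⟧ (suc m) j) ⟩
    - (suc m · 1# * ⟦ j ⟧) ≈⟨ -‿distribˡ-* _ _ ⟩
    - (suc m · 1#) * ⟦ j ⟧ ∎

  morphism : ℤ.+-*-rawRing -Raw-AlmostCommutative⟶ fromCommutativeRing R
  morphism = record
    { ⟦_⟧ = ⟦_⟧ ; +-homo = ⟦+⟧ ; *-homo = ⟦*⟧ ; -‿homo = ⟦-⟧ ; 0-homo = refl ; 1-homo = refl }

  _≟_ : ∀ i j → Maybe (⟦ i ⟧ ≈ ⟦ j ⟧)
  i ≟ j with i ℤ.≟ j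
  ... | yes i≡j = just (reflexive (≡.cong ⟦_⟧ i≡j))
  ... | no _ = nothing

  open Algebra.Solver.Ring ℤ.+-*-rawRing (fromCommutativeRing R) morphism _≟_ public
    using (solve; _:=_; _:+_; _:*_; _:-_; :-_; con)

-- Finite sums

module FiniteSums {c ℓ : Level} (R : CommutativeRing c ℓ) where
  open CommutativeRing R hiding (zero)
  open Hseries R
  open IntegerCoefficients R using (solve; _:=_; _:+_; _:-_)
  open import Relation.Binary.Reasoning.Setoid setoid

  sum-cong : ∀ n {f g} → (∀ i → i < n → f i ≈ g i) → sumBelow n f ≈ sumBelow n g
  sum-cong zero h = refl
  sum-cong (suc n) h = +-cong (sum-cong n (λ i i<n → h i (ℕₚ.m<n⇒m<1+n i<n))) (h n (ℕₚ.n<1+n n))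

  sum-zero : ∀ n {f} → (∀ i → i < n → f i ≈ 0#) → sumBelow n f ≈ 0#
  sum-zero zero h = refl
  sum-zero (suc n) h =
    trans (+-cong (sum-zero n (λ i i<n → h i (ℕₚ.m<n⇒m<1+n i<n))) (h n (ℕₚ.n<1+n n))) (+-identityˡ 0#)

  sum-+ : ∀ n f g → sumBelow n (λ i → f i + g i) ≈ sumBelow n f + sumBelow n g
  sum-+ zero f g = sym (+-identityˡ 0#)
  sum-+ (suc n) f g = trans (+-congʳ (sum-+ n f g))
    (solve 4 (λ a b x y → (a :+ b) :+ (x :+ y) := (a :+ x) :+ (b :+ y)) refl _ _ _ _)

  sum-*ˡ : ∀ n a f → sumBelow n (λ i → a * f i) ≈ a * sumBelow n f
  sum-*ˡ zero a f = sym (zeroʳ a)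
  sum-*ˡ (suc n) a f = trans (+-congʳ (sum-*ˡ n a f)) (sym (distribˡ a _ _))

  sum-swap : ∀ m n (f : ℕ → ℕ → Carrier) →
    sumBelow m (λ i → sumBelow n (f i)) ≈ sumBelow n (λ j → sumBelow m (λ i → f i j))
  sum-swap zero n f = sym (sum-zero n (λ _ _ → refl))
  sum-swap (suc m) n f = trans (+-congʳ (sum-swap m n f)) (sym (sum-+ n _ _))

  sum-split : ∀ m n f → sumBelow (m ℕ.+ n) f ≈ sumBelow m f + sumBelow n (λ i → f (m ℕ.+ i))
  sum-split m zero f = trans (reflexive (≡.cong (λ k → sumBelow k f) (ℕₚ.+-identityʳ m))) (sym (+-identityʳ _))
  sum-split m (suc n) f = begin
    sumBelow (m ℕ.+ suc n) f ≡⟨ ≡.cong (λ k → sumBelow k f) (ℕₚ.+-suc m n) ⟩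
    sumBelow (m ℕ.+ n) f + f (m ℕ.+ n) ≈⟨ +-congʳ (sum-split m n f) ⟩
    sumBelow m f + sumBelow n (λ i → f (m ℕ.+ i)) + f (m ℕ.+ n) ≈⟨ +-assoc _ _ _ ⟩
    sumBelow m f + sumBelow (suc n) (λ i → f (m ℕ.+ i)) ∎

  sum-head : ∀ n f → sumBelow (suc n) f ≈ f 0 + sumBelow n (λ i → f (suc i))
  sum-head n f = trans (sum-split 1 n f) (+-congʳ (+-identityˡ _))

  sum-truncate : ∀ {m n} f → m ≤ n → (∀ i → m ≤ i → f i ≈ 0#) → sumBelow n f ≈ sumBelow m f
  sum-truncate {m} {n} f m≤n h = begin
    sumBelow n f ≡⟨ ≡.cong (λ k → sumBelow k f) (≡.sym (ℕₚ.m+[n∸m]≡n m≤n)) ⟩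
    sumBelow (m ℕ.+ (n ∸ m)) f ≈⟨ sum-split m (n ∸ m) f ⟩
    sumBelow m f + sumBelow (n ∸ m) (λ i → f (m ℕ.+ i))
      ≈⟨ +-congˡ (sum-zero (n ∸ m) (λ i _ → h (m ℕ.+ i) (ℕₚ.m≤m+n m i))) ⟩
    sumBelow m f + 0# ≈⟨ +-identityʳ _ ⟩
    sumBelow m f ∎

  -- The mirror index is given by an equation `suc (i + j) ≡ n` rather than by truncated
  -- subtraction; the reflection lemmas for r ↔ N - 1 - r have the same form.
  sum-reverse : ∀ n (f g : ℕ → Carrier) → (∀ i j → suc (i ℕ.+ j) ≡ n → f i ≈ g j) →
    sumBelow n f ≈ sumBelow n g
  sum-reverse zero f g h = refl
  sum-reverse (suc n) f g h = begin
    sumBelow n f + f n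
      ≈⟨ +-cong (sum-reverse n f (λ j → g (suc j)) (λ i j e → h i (suc j) (≡.cong suc (≡.trans (ℕₚ.+-suc i j) e))))
                (h n 0 (≡.cong suc (ℕₚ.+-identityʳ n))) ⟩
    sumBelow n (λ j → g (suc j)) + g 0 ≈⟨ +-comm _ _ ⟩
    g 0 + sumBelow n (λ j → g (suc j)) ≈⟨ sum-head n g ⟨
    sumBelow (suc n) g ∎

  sumTo≈sumBelow : ∀ n f → sumTo n f ≈ sumBelow (suc n) f
  sumTo≈sumBelow zero f = sym (+-identityˡ _)
  sumTo≈sumBelow (suc n) f = +-congʳ (sumTo≈sumBelow n f)

  sum-telescope : ∀ n (f : ℕ → Carrier) → sumBelow n (λ i → f (suc i) - f i) ≈ f n - f 0
  sum-telescope zero f = sym (-‿inverseʳ _)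
  sum-telescope (suc n) f = trans (+-congʳ (sum-telescope n f))
    (solve 3 (λ a b x → (a :- x) :+ (b :- a) := b :- x) refl _ _ _)

-- Powers

module Powers {c ℓ : Level} (R : CommutativeRing c ℓ) where
  open CommutativeRing R hiding (zero)
  open Hseries R
  open IntegerCoefficients R using (solve; _:=_; _:*_)
  open import Relation.Binary.Reasoning.Setoid setoid

  pow-≡ : ∀ x {a b} → a ≡ b → pow x a ≈ pow x b
  pow-≡ x e = reflexive (≡.cong (pow x) e)

  pow-+ : ∀ x a b → pow x (a ℕ.+ b) ≈ pow x a * pow x b
  pow-+ x zero b = sym (*-identityˡ _)
  pow-+ x (suc a) b = trans (*-congʳ (pow-+ x a b))
    (solve 3 (λ u v y → (u :* v) :* y := (u :* y) :* v) refl _ _ _)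

  pow-cong : ∀ {x y} n → x ≈ y → pow x n ≈ pow y n
  pow-cong zero e = refl
  pow-cong (suc n) e = *-cong (pow-cong n e) e

  pow-1 : ∀ n → pow 1# n ≈ 1#
  pow-1 zero = refl
  pow-1 (suc n) = trans (*-identityʳ _) (pow-1 n)

  pow-distrib : ∀ x y n → pow (x * y) n ≈ pow x n * pow y n
  pow-distrib x y zero = sym (*-identityˡ _)
  pow-distrib x y (suc n) = trans (*-congʳ (pow-distrib x y n))
    (solve 4 (λ a b u v → (a :* b) :* (u :* v) := (a :* u) :* (b :* v)) refl _ _ _ _)

  pow-* : ∀ x m n → pow x (n ℕ.* m) ≈ pow (pow x m) n
  pow-* x m zero = refl
  pow-* x m (suc n) = trans (pow-+ x m (n ℕ.* m)) (trans (*-comm _ _) (*-congʳ (pow-* x m n)))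

  pow-split : ∀ x {e} a b → e ≡ a ℕ.+ b → pow x e ≈ pow x a * pow x b
  pow-split x a b e = trans (pow-≡ x e) (pow-+ x a b)

-- Gaussian binomial coefficients in a commutative ring

module GaussianBinomials {c ℓ : Level} (R : CommutativeRing c ℓ) (q : CommutativeRing.Carrier R) where
  open CommutativeRing R hiding (zero)
  open Hseries R
  open IntegerCoefficients R using (solve; _:=_; _:+_; _:*_; _:-_; :-_; con)
  open FiniteSums R
  open Powers R
  open import Relation.Binary.Reasoning.Setoid setoid

  [_,_] : ℕ → ℕ → Carrier
  [ n , k ] = qbin q n k

  bin-≡ : ∀ k {m n} → m ≡ n → [ m , k ] ≈ [ n , k ]
  bin-≡ k e = reflexive (≡.cong (λ n → [ n , k ]) e)

  bin-> : ∀ {n k} → n < k → [ n , k ] ≈ 0#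
  bin-> {zero} {suc k} _ = refl
  bin-> {suc n} {suc k} (s≤s n<k) = begin
    [ n , k ] + pow q (suc k) * [ n , suc k ]
      ≈⟨ +-cong (bin-> n<k) (*-congˡ (bin-> (ℕₚ.m<n⇒m<1+n n<k))) ⟩
    0# + pow q (suc k) * 0# ≈⟨ solve 1 (λ x → con (+ 0) :+ x :* con (+ 0) := con (+ 0)) refl _ ⟩
    0# ∎

  bin-zero : ∀ n → [ n , 0 ] ≈ 1#
  bin-zero zero = refl
  bin-zero (suc n) = refl

  bin-self : ∀ n → [ n , n ] ≈ 1#
  bin-self zero = refl
  bin-self (suc n) = begin
    [ n , n ] + pow q (suc n) * [ n , suc n ] ≈⟨ +-cong (bin-self n) (*-congˡ (bin-> (ℕₚ.n<1+n n))) ⟩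
    1# + pow q (suc n) * 0# ≈⟨ solve 1 (λ x → con (+ 1) :+ x :* con (+ 0) := con (+ 1)) refl _ ⟩
    1# ∎

  -- The definition of `qbin` provides one of the two q-Pascal rules; this is the other. Writing the
  -- upper index as k + e makes the exponent n - k the variable e, and the induction runs over both
  -- k and e.
  pascal-dual-+ : ∀ k e → [ suc (k ℕ.+ e) , suc k ] ≈ [ k ℕ.+ e , suc k ] + pow q e * [ k ℕ.+ e , k ]
  pascal-dual-+ zero zero = solve 1 (λ x → con (+ 1) :+ x :* con (+ 0) := con (+ 0) :+ con (+ 1) :* con (+ 1)) refl _
  pascal-dual-+ zero (suc e) = begin
    1# + 1# * q * [ suc e , 1 ] ≈⟨ +-congˡ (*-congˡ (pascal-dual-+ zero e)) ⟩
    1# + 1# * q * ([ e , 1 ] + pow q e * [ e , 0 ]) ≈⟨ +-congˡ (*-congˡ (+-congˡ (*-congˡ (bin-zero e)))) ⟩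
    1# + 1# * q * ([ e , 1 ] + pow q e * 1#)
      ≈⟨ solve 3 (λ q y x → con (+ 1) :+ con (+ 1) :* q :* (y :+ x :* con (+ 1))
                         := (con (+ 1) :+ con (+ 1) :* q :* y) :+ x :* q :* con (+ 1)) refl _ _ _ ⟩
    (1# + 1# * q * [ e , 1 ]) + pow q e * q * 1# ≈⟨ +-congʳ (+-congʳ (bin-zero e)) ⟨
    ([ e , 0 ] + 1# * q * [ e , 1 ]) + pow q e * q * 1# ∎
  pascal-dual-+ (suc k) zero = begin
    [ suc (suc (k ℕ.+ 0)) , suc (suc k) ]
      ≈⟨ bin-≡ (suc (suc k)) (≡.cong (λ i → suc (suc i)) (ℕₚ.+-identityʳ k)) ⟩
    [ suc (suc k) , suc (suc k) ] ≈⟨ bin-self (suc (suc k)) ⟩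
    1# ≈⟨ solve 0 (con (+ 1) := con (+ 0) :+ con (+ 1) :* con (+ 1)) refl ⟩
    0# + 1# * 1# ≈⟨ +-cong (bin-> (ℕₚ.n<1+n (suc k))) (*-congˡ (bin-self (suc k))) ⟨
    [ suc k , suc (suc k) ] + 1# * [ suc k , suc k ]
      ≈⟨ +-cong (bin-≡ (suc (suc k)) p) (*-congˡ (bin-≡ (suc k) p)) ⟨
    [ suc (k ℕ.+ 0) , suc (suc k) ] + 1# * [ suc (k ℕ.+ 0) , suc k ] ∎
    where
    p : suc (k ℕ.+ 0) ≡ suc k
    p = ≡.cong suc (ℕₚ.+-identityʳ k)
  pascal-dual-+ (suc k) (suc e) = begin
    [ suc (k ℕ.+ suc e) , suc k ] + pow q (suc k) * q * [ suc (k ℕ.+ suc e) , suc (suc k) ]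
      ≈⟨ +-cong (pascal-dual-+ k (suc e))
          (*-congˡ (trans (bin-≡ (suc (suc k)) (≡.cong suc (ℕₚ.+-suc k e)))
            (trans (pascal-dual-+ (suc k) e) (sym (+-cong (bin-≡ (suc (suc k)) p) (*-congˡ (bin-≡ (suc k) p))))))) ⟩
    [ k ℕ.+ suc e , suc k ] + pow q e * q * [ k ℕ.+ suc e , k ]
      + pow q (suc k) * q * ([ k ℕ.+ suc e , suc (suc k) ] + pow q e * [ k ℕ.+ suc e , suc k ])
      ≈⟨ solve 6 (λ q x y a b d → a :+ x :* q :* b :+ y :* q :* (d :+ x :* a)
                               := (a :+ y :* q :* d) :+ x :* q :* (b :+ y :* a)) refl
           q (pow q e) (pow q (suc k)) [ k ℕ.+ suc e , suc k ] [ k ℕ.+ suc e , k ] [ k ℕ.+ suc e , suc (suc k) ] ⟩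
    [ suc (k ℕ.+ suc e) , suc (suc k) ] + pow q e * q * [ suc (k ℕ.+ suc e) , suc k ] ∎
    where
    p : k ℕ.+ suc e ≡ suc k ℕ.+ e
    p = ℕₚ.+-suc k e

  pascal-dual : ∀ {n} k e → n ≡ k ℕ.+ e → [ suc n , suc k ] ≈ [ n , suc k ] + pow q e * [ n , k ]
  pascal-dual k e ≡.refl = pascal-dual-+ k e

  -- The symmetry exchanges the two Pascal rules, so expanding one side by the definition yields the
  -- dual rule for the other.
  bin-sym : ∀ a b → [ a ℕ.+ b , a ] ≈ [ a ℕ.+ b , b ]
  bin-sym zero b = trans (bin-zero b) (sym (bin-self b))
  bin-sym (suc a) zero = trans (bin-≡ (suc a) (ℕₚ.+-identityʳ (suc a))) (bin-self (suc a))
  bin-sym (suc a) (suc b) = begin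
    [ a ℕ.+ suc b , a ] + pow q (suc a) * [ a ℕ.+ suc b , suc a ]
      ≈⟨ +-cong (bin-sym a (suc b)) (*-congˡ (trans (bin-≡ (suc a) p) (trans (bin-sym (suc a) b) (bin-≡ b (≡.sym p))))) ⟩
    [ a ℕ.+ suc b , suc b ] + pow q (suc a) * [ a ℕ.+ suc b , b ]
      ≈⟨ pascal-dual b (suc a) (≡.trans p (ℕₚ.+-comm (suc a) b)) ⟨
    [ suc (a ℕ.+ suc b) , suc b ] ∎
    where
    p : a ℕ.+ suc b ≡ suc a ℕ.+ b
    p = ℕₚ.+-suc a b

  φ : ℕ → Carrier
  φ = qpoch q q

  -- Kept free of denominators, so that it also holds where some (q)_k vanishes. The step is 1 -
  -- q^(a+b+2) = (1 - q^(a+1)) + q^(a+1) (1 - q^(b+1)).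
  bin-φ : ∀ a b → [ a ℕ.+ b , a ] * (φ a * φ b) ≈ φ (a ℕ.+ b)
  bin-φ zero b = trans (*-congʳ (bin-zero b)) (trans (*-identityˡ _) (*-identityˡ _))
  bin-φ (suc a) zero = begin
    [ suc (a ℕ.+ 0) , suc a ] * (φ (suc a) * 1#)
      ≈⟨ *-cong (trans (bin-≡ (suc a) (ℕₚ.+-identityʳ (suc a))) (bin-self (suc a))) (*-identityʳ _) ⟩
    1# * φ (suc a) ≈⟨ *-identityˡ _ ⟩
    φ (suc a) ≡⟨ ≡.cong φ (ℕₚ.+-identityʳ (suc a)) ⟨
    φ (suc (a ℕ.+ 0)) ∎
  bin-φ (suc a) (suc b) = begin
    ([ a ℕ.+ suc b , a ] + pow q a * q * [ a ℕ.+ suc b , suc a ])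
      * (φ a * (1# - q * pow q a) * (φ b * (1# - q * pow q b)))
      ≈⟨ solve 7 (λ q x y u v f g →
           (f :+ x :* q :* g) :* ((u :* (con (+ 1) :- q :* x)) :* (v :* (con (+ 1) :- q :* y)))
           := (con (+ 1) :- q :* x) :* (f :* (u :* (v :* (con (+ 1) :- q :* y))))
           :+ (x :* q :* (con (+ 1) :- q :* y)) :* (g :* ((u :* (con (+ 1) :- q :* x)) :* v)))
           refl q (pow q a) (pow q b) (φ a) (φ b) [ a ℕ.+ suc b , a ] [ a ℕ.+ suc b , suc a ] ⟩
    (1# - q * pow q a) * ([ a ℕ.+ suc b , a ] * (φ a * φ (suc b)))
      + pow q a * q * (1# - q * pow q b) * ([ a ℕ.+ suc b , suc a ] * (φ (suc a) * φ b))
      ≈⟨ +-cong (*-congˡ (bin-φ a (suc b)))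
           (*-congˡ (trans (*-congʳ (bin-≡ (suc a) p)) (trans (bin-φ (suc a) b) (reflexive (≡.cong φ (≡.sym p)))))) ⟩
    (1# - q * pow q a) * φ (a ℕ.+ suc b) + pow q a * q * (1# - q * pow q b) * φ (a ℕ.+ suc b)
      ≈⟨ solve 4 (λ q x y w → (con (+ 1) :- q :* x) :* w :+ (x :* q :* (con (+ 1) :- q :* y)) :* w
                           := w :* (con (+ 1) :- q :* (x :* (y :* q)))) refl q (pow q a) (pow q b) _ ⟩
    φ (a ℕ.+ suc b) * (1# - q * (pow q a * pow q (suc b)))
      ≈⟨ *-congˡ (+-congˡ (-‿cong (*-congˡ (pow-+ q a (suc b))))) ⟨
    φ (suc (a ℕ.+ suc b)) ∎
    where
    p : a ℕ.+ suc b ≡ suc a ℕ.+ b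
    p = ℕₚ.+-suc a b

  φ-+ : ∀ a b → φ a * qpoch q (pow q (suc a)) b ≈ φ (a ℕ.+ b)
  φ-+ a zero = trans (*-identityʳ _) (reflexive (≡.cong φ (≡.sym (ℕₚ.+-identityʳ a))))
  φ-+ a (suc b) = begin
    φ a * (qpoch q (pow q (suc a)) b * (1# - pow q a * q * pow q b))
      ≈⟨ solve 5 (λ q x y u v → u :* (v :* (con (+ 1) :- x :* q :* y)) := (u :* v) :* (con (+ 1) :- q :* (x :* y)))
           refl q (pow q a) (pow q b) _ _ ⟩
    φ a * qpoch q (pow q (suc a)) b * (1# - q * (pow q a * pow q b))
      ≈⟨ *-cong (φ-+ a b) (+-congˡ (-‿cong (*-congˡ (sym (pow-+ q a b))))) ⟩
    φ (suc (a ℕ.+ b)) ≡⟨ ≡.cong φ (ℕₚ.+-suc a b) ⟨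
    φ (a ℕ.+ suc b) ∎

  qpoch-cong : ∀ {x y} n → x ≈ y → qpoch q x n ≈ qpoch q y n
  qpoch-cong zero e = refl
  qpoch-cong (suc n) e = *-cong (qpoch-cong n e) (+-congˡ (-‿cong (*-congʳ e)))

  qpoch-head : ∀ x n → qpoch q x (suc n) ≈ (1# - x) * qpoch q (x * q) n
  qpoch-head x zero = solve 1 (λ x → con (+ 1) :* (con (+ 1) :- x :* con (+ 1)) := (con (+ 1) :- x) :* con (+ 1)) refl x
  qpoch-head x (suc n) = begin
    qpoch q x (suc n) * (1# - x * pow q (suc n)) ≈⟨ *-congʳ (qpoch-head x n) ⟩
    (1# - x) * qpoch q (x * q) n * (1# - x * (pow q n * q))
      ≈⟨ solve 4 (λ x q p y → (con (+ 1) :- x) :* p :* (con (+ 1) :- x :* (y :* q))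
                           := (con (+ 1) :- x) :* (p :* (con (+ 1) :- (x :* q) :* y))) refl x q _ _ ⟩
    (1# - x) * qpoch q (x * q) (suc n) ∎

  -- The q-Vandermonde sum with one parameter sent to infinity.
  vandermonde : ∀ d z →
    sumBelow (suc d) (λ i → pow z i * pow q (i ℕ.* i) * [ d , i ] * qpoch q (z * pow q (suc i)) (d ∸ i)) ≈ 1#
  vandermonde zero z = solve 0 (con (+ 0) :+ con (+ 1) :* con (+ 1) :* con (+ 1) :* con (+ 1) := con (+ 1)) refl
  vandermonde (suc d) z = begin
    sumBelow (suc (suc d)) f ≈⟨ sum-head (suc d) f ⟩
    f 0 + sumBelow (suc d) (λ i → f (suc i))
      ≈⟨ +-cong f0 (sum-cong (suc d) (λ i _ → fsuc i)) ⟩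
    h 0 + sumBelow (suc d) (λ i → g i + h (suc i)) ≈⟨ +-congˡ (sum-+ (suc d) g _) ⟩
    h 0 + (sumBelow (suc d) g + sumBelow (suc d) (λ i → h (suc i)))
      ≈⟨ solve 3 (λ x y z → x :+ (y :+ z) := y :+ (x :+ z)) refl _ _ _ ⟩
    sumBelow (suc d) g + (h 0 + sumBelow (suc d) (λ i → h (suc i))) ≈⟨ +-congˡ (sum-head (suc d) h) ⟨
    sumBelow (suc d) g + sumBelow (suc (suc d)) h
      ≈⟨ +-congˡ (sum-truncate h (ℕₚ.n≤1+n (suc d)) h-zero) ⟩
    sumBelow (suc d) g + sumBelow (suc d) h ≈⟨ sum-+ (suc d) g h ⟨
    -- The two terms with `[ d , i ]` carry the weights z q^(i+1) and 1 - z q^(i+1) on a common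
    -- factor, which is the summand for d with z q in place of z. Hence z has to stay general in the
    -- induction.
    sumBelow (suc d) (λ i → g i + h i) ≈⟨ sum-cong (suc d) (λ i i<d → g+h i (ℕₚ.≤-pred i<d)) ⟩
    sumBelow (suc d) (λ i → pow (z * q) i * pow q (i ℕ.* i) * [ d , i ] * qpoch q (z * q * pow q (suc i)) (d ∸ i))
      ≈⟨ vandermonde d (z * q) ⟩
    1# ∎
    where
    f g h : ℕ → Carrier
    f i = pow z i * pow q (i ℕ.* i) * [ suc d , i ] * qpoch q (z * pow q (suc i)) (suc d ∸ i)
    g i = pow z (suc i) * pow q (suc i ℕ.* suc i) * [ d , i ] * qpoch q (z * pow q (suc (suc i))) (d ∸ i)
    h i = pow z i * pow q (i ℕ.* i) * pow q i * [ d , i ] * qpoch q (z * pow q (suc i)) (suc d ∸ i)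

    f0 : f 0 ≈ h 0
    f0 = *-congʳ (trans (solve 0 (con (+ 1) :* con (+ 1) :* con (+ 1) := con (+ 1) :* con (+ 1) :* con (+ 1) :* con (+ 1)) refl)
                        (*-congˡ (sym (bin-zero d))))

    fsuc : ∀ i → f (suc i) ≈ g i + h (suc i)
    fsuc i = solve 6 (λ a b x y u p → a :* b :* (x :+ u :* y) :* p := a :* b :* x :* p :+ a :* b :* u :* y :* p)
      refl _ _ _ _ _ _

    h-zero : ∀ i → suc d ≤ i → h i ≈ 0#
    h-zero i d<i = trans (*-congʳ (*-congˡ (bin-> d<i))) (solve 2 (λ a b → a :* con (+ 0) :* b := con (+ 0)) refl _ _)

    g+h : ∀ i → i ≤ d → g i + h i ≈ pow (z * q) i * pow q (i ℕ.* i) * [ d , i ] * qpoch q (z * q * pow q (suc i)) (d ∸ i)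
    g+h i i≤d = begin
      g i + h i
        ≈⟨ +-cong
            (*-cong (*-congʳ (*-congˡ (trans (pow-≡ q (square i)) (trans (pow-+ q (i ℕ.* i) (i ℕ.+ suc i))
                (*-congˡ (pow-+ q i (suc i))))))) (qpoch-cong (d ∸ i) (sym shift)))
            (*-congˡ (trans (reflexive (≡.cong (qpoch q (z * pow q (suc i))) (ℕₚ.+-∸-assoc 1 i≤d)))
               (trans (qpoch-head (z * pow q (suc i)) (d ∸ i)) (*-congˡ (qpoch-cong (d ∸ i) shift′))))) ⟩
      pow z i * z * (s * (t * (t * q))) * b * w + pow z i * s * t * b * ((1# - z * (t * q)) * w)
        ≈⟨ solve 7 (λ a z s t q b w → a :* z :* (s :* (t :* (t :* q))) :* b :* w
                      :+ a :* s :* t :* b :* ((con (+ 1) :- z :* (t :* q)) :* w)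
                    := (a :* t) :* s :* b :* w) refl (pow z i) z s t q b w ⟩
      pow z i * t * s * b * w ≈⟨ *-congʳ (*-congʳ (*-congʳ (pow-distrib z q i))) ⟨
      pow (z * q) i * s * b * w ∎
      where
      s t b w : Carrier
      s = pow q (i ℕ.* i)
      t = pow q i
      b = [ d , i ]
      w = qpoch q (z * q * pow q (suc i)) (d ∸ i)
      square : ∀ i → suc i ℕ.* suc i ≡ i ℕ.* i ℕ.+ (i ℕ.+ suc i)
      square = solve-∀
      shift : z * q * pow q (suc i) ≈ z * pow q (suc (suc i))
      shift = solve 3 (λ z q t → z :* q :* (t :* q) := z :* (t :* q :* q)) refl z q t
      shift′ : z * pow q (suc i) * q ≈ z * q * pow q (suc i)
      shift′ = solve 3 (λ z q t → z :* (t :* q) :* q := z :* q :* (t :* q)) refl z q t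

-- Central binomials and the Bailey kernel for a = q

module CentralBinomials {c ℓ : Level} (R : CommutativeRing c ℓ) (q : CommutativeRing.Carrier R) where
  open CommutativeRing R hiding (zero)
  open Hseries R
  open IntegerCoefficients R using (solve; _:=_; _:+_; _:*_; _:-_; :-_; con)
  open FiniteSums R
  open Powers R
  open GaussianBinomials R q
  open import Relation.Binary.Reasoning.Setoid setoid

  -- [2m, m-r] written symmetrically as [2m, r+m], which is zero for r > m without truncated subtraction.
  x : ℕ → ℕ → Carrier
  x m j = [ m ℕ.+ m , j ℕ.+ m ]

  -- The Bailey kernel relative to a = q with denominators cleared: (1 - q^(2r+1)) (q)_(2m) /
  -- ((q)_(m-r) (q)_(m+r+1)), see `B-φ`. The difference of binomials stays meaningful when these
  -- factors vanish.
  B : ℕ → ℕ → Carrier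
  B m r = x m r - pow q (suc (r ℕ.+ r)) * x m (suc r)

  x-zero : ∀ {m j} → m < j → x m j ≈ 0#
  x-zero {m} m<j = bin-> (ℕₚ.+-monoˡ-< m m<j)

  B-zero : ∀ {m r} → m < r → B m r ≈ 0#
  B-zero m<r = trans (+-cong (x-zero m<r) (-‿cong (*-congˡ (x-zero (ℕₚ.m<n⇒m<1+n m<r)))))
    (solve 1 (λ a → con (+ 0) :- a :* con (+ 0) := con (+ 0)) refl _)

  x-suc : ∀ m j → x (suc m) j ≈ [ suc (suc (m ℕ.+ m)) , suc (j ℕ.+ m) ]
  x-suc m j = reflexive (≡.cong₂ (qbin q) (≡.cong suc (ℕₚ.+-suc m m)) (ℕₚ.+-suc j m))

  x-step : ∀ {m} r e → r ℕ.+ e ≡ m →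
    x (suc m) (suc r) ≈ x m (suc r) + pow q (suc (suc (r ℕ.+ m))) * x m (suc (suc r))
      + pow q e * (x m r + pow q (suc (r ℕ.+ m)) * x m (suc r))
  x-step {m} r e p = trans (x-suc m (suc r)) (pascal-dual (suc (r ℕ.+ m)) e (≡.cong suc (index p)))
    where
    index : ∀ {m} → r ℕ.+ e ≡ m → m ℕ.+ m ≡ r ℕ.+ m ℕ.+ e
    index ≡.refl = identity r e
      where
      identity : ∀ r e → r ℕ.+ e ℕ.+ (r ℕ.+ e) ≡ r ℕ.+ (r ℕ.+ e) ℕ.+ e
      identity = solve-∀

  -- Both sides are expansions of [2m+1, m+r+2], one by each Pascal rule.
  x-absorb : ∀ {m} r e → suc (r ℕ.+ e) ≡ m →
    x m (suc r) + pow q (suc (suc (r ℕ.+ m))) * x m (suc (suc r)) ≈ x m (suc (suc r)) + pow q e * x m (suc r)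
  x-absorb {m} r e p = pascal-dual (suc (r ℕ.+ m)) e (index p)
    where
    index : ∀ {m} → suc (r ℕ.+ e) ≡ m → m ℕ.+ m ≡ suc (r ℕ.+ m) ℕ.+ e
    index ≡.refl = identity r e
      where
      identity : ∀ r e → suc (r ℕ.+ e) ℕ.+ suc (r ℕ.+ e) ≡ suc (r ℕ.+ suc (r ℕ.+ e)) ℕ.+ e
      identity = solve-∀

  x-top : ∀ m → x m m ≈ 1#
  x-top m = bin-self (m ℕ.+ m)

  -- Multiplied through by a power of q; after division by q^((m+1)²) the right-hand side is a difference in m.
  x-telescope : ∀ m r →
    pow q (suc m) * (x m r - pow q (suc (suc (suc (r ℕ.+ r)))) * x m (suc (suc (suc r))))
      ≈ pow q (suc r) * ((x (suc m) (suc r) - x (suc m) (suc (suc r)))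
                          - pow q (suc (m ℕ.+ m)) * (x m (suc r) - x m (suc (suc r))))
  x-telescope m r with ℕₚ.<-cmp r m
  ... | tri> _ _ m<r = begin
    pow q (suc m) * (x m r - a * x m (suc (suc (suc r))))
      ≈⟨ *-congˡ (+-cong (x-zero m<r) (-‿cong (*-congˡ (x-zero (ℕₚ.m<n⇒m<1+n (ℕₚ.m<n⇒m<1+n (ℕₚ.m<n⇒m<1+n m<r))))))) ⟩
    pow q (suc m) * (0# - a * 0#)
      ≈⟨ solve 4 (λ a b c d → a :* (con (+ 0) :- b :* con (+ 0))
           := c :* ((con (+ 0) :- con (+ 0)) :- d :* (con (+ 0) :- con (+ 0)))) refl _ _ _ _ ⟩
    pow q (suc r) * ((0# - 0#) - b * (0# - 0#))
      ≈⟨ *-congˡ (+-cong (+-cong (x-zero (s≤s m<r)) (-‿cong (x-zero (s≤s (ℕₚ.m<n⇒m<1+n m<r)))))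
           (-‿cong (*-congˡ (+-cong (x-zero (ℕₚ.m<n⇒m<1+n m<r)) (-‿cong (x-zero (ℕₚ.m<n⇒m<1+n (ℕₚ.m<n⇒m<1+n m<r)))))))) ⟨
    pow q (suc r) * ((x (suc m) (suc r) - x (suc m) (suc (suc r))) - b * (x m (suc r) - x m (suc (suc r)))) ∎
    where
    a b : Carrier
    a = pow q (suc (suc (suc (r ℕ.+ r))))
    b = pow q (suc (m ℕ.+ m))
  -- Here m - r - 1 is not a natural number, so the exponent e of the generic case is missing; only
  -- the top coefficients, equal to 1, survive.
  ... | tri≈ _ ≡.refl _ = begin
    pow q (suc m) * (x m m - a * x m (suc (suc (suc m))))
      ≈⟨ *-congˡ (+-cong (x-top m) (-‿cong (*-congˡ (x-zero (ℕₚ.m<n⇒m<1+n (ℕₚ.m<n⇒m<1+n (ℕₚ.n<1+n m))))))) ⟩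
    pow q (suc m) * (1# - a * 0#)
      ≈⟨ solve 3 (λ a b d → a :* (con (+ 1) :- b :* con (+ 0))
           := a :* ((con (+ 1) :- con (+ 0)) :- d :* (con (+ 0) :- con (+ 0)))) refl _ _ _ ⟩
    pow q (suc m) * ((1# - 0#) - b * (0# - 0#))
      ≈⟨ *-congˡ (+-cong (+-cong (x-top (suc m)) (-‿cong (x-zero (ℕₚ.n<1+n (suc m)))))
           (-‿cong (*-congˡ (+-cong (x-zero (ℕₚ.n<1+n m)) (-‿cong (x-zero (ℕₚ.m<n⇒m<1+n (ℕₚ.n<1+n m)))))))) ⟨
    pow q (suc m) * ((x (suc m) (suc m) - x (suc m) (suc (suc m))) - b * (x m (suc m) - x m (suc (suc m)))) ∎
    where
    a b : Carrier
    a = pow q (suc (suc (suc (m ℕ.+ m))))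
    b = pow q (suc (m ℕ.+ m))
  ... | tri< r<m _ _ with ℕₚ.m≤n⇒∃[o]m+o≡n r<m
  ...   | e , p = sym (begin
    pow q (suc r) * ((x (suc m) (suc r) - x (suc m) (suc (suc r))) - pow q (suc (m ℕ.+ m)) * (x₁ - x₂))
      ≈⟨ *-congˡ (+-cong (+-cong
           (trans (x-step r (suc e) (≡.trans (ℕₚ.+-suc r e) p))
             (+-cong (+-congˡ (*-congʳ (*-congʳ (*-congʳ r+m)))) (*-congˡ (+-congˡ (*-congʳ (*-congʳ r+m))))))
           (-‿cong (trans (x-step (suc r) e p)
             (+-cong (+-congˡ (*-congʳ (*-congʳ (*-congʳ (*-congʳ r+m))))) (*-congˡ (+-congˡ (*-congʳ (*-congʳ (*-congʳ r+m)))))))))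
           (-‿cong (*-congʳ (*-congʳ (trans (pow-+ q m m) (*-cong pm pm)))))) ⟩
    u * q * (((x₁ + u * (u * t * q) * q * q * x₂ + t * q * (x₀ + u * (u * t * q) * q * x₁))
              - (x₂ + u * (u * t * q) * q * q * q * x₃ + t * (x₁ + u * (u * t * q) * q * q * x₂)))
              - u * t * q * (u * t * q) * q * (x₁ - x₂))
      ≈⟨ solve 7 (λ u t q x₀ x₁ x₂ x₃ →
           u :* q :* (((x₁ :+ u :* (u :* t :* q) :* q :* q :* x₂ :+ t :* q :* (x₀ :+ u :* (u :* t :* q) :* q :* x₁))
              :- (x₂ :+ u :* (u :* t :* q) :* q :* q :* q :* x₃ :+ t :* (x₁ :+ u :* (u :* t :* q) :* q :* q :* x₂)))
              :- u :* t :* q :* (u :* t :* q) :* q :* (x₁ :- x₂))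
           := u :* t :* q :* q :* (x₀ :- u :* u :* q :* q :* q :* x₃)
              :+ u :* q :* ((x₁ :+ u :* (u :* t :* q) :* q :* q :* x₂) :- (x₂ :+ t :* x₁))) refl u t q x₀ x₁ x₂ x₃ ⟩
    u * t * q * q * (x₀ - u * u * q * q * q * x₃)
      + u * q * ((x₁ + u * (u * t * q) * q * q * x₂) - (x₂ + t * x₁))
      -- After both Pascal expansions the two sides differ by q^(r+1) times the difference of the
      -- two sides of `x-absorb`.
      ≈⟨ +-congˡ (*-congˡ (+-congʳ (trans (+-congˡ (*-congʳ (*-congʳ (*-congʳ (sym r+m))))) (x-absorb r e p)))) ⟩
    u * t * q * q * (x₀ - u * u * q * q * q * x₃) + u * q * ((x₂ + t * x₁) - (x₂ + t * x₁))
      ≈⟨ solve 3 (λ a b c → a :+ b :* (c :- c) := a) refl _ _ _ ⟩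
    u * t * q * q * (x₀ - u * u * q * q * q * x₃)
      ≈⟨ *-cong (*-congʳ (sym pm)) (+-congˡ (-‿cong (*-congʳ (*-congʳ (*-congʳ (*-congʳ (sym (pow-+ q r r)))))))) ⟩
    pow q (suc m) * (x₀ - pow q (suc (suc (suc (r ℕ.+ r)))) * x₃) ∎)
    where
    u t x₀ x₁ x₂ x₃ : Carrier
    u = pow q r
    t = pow q e
    x₀ = x m r
    x₁ = x m (suc r)
    x₂ = x m (suc (suc r))
    x₃ = x m (suc (suc (suc r)))
    pm : pow q m ≈ u * t * q
    pm = trans (pow-≡ q (≡.sym p)) (*-congʳ (pow-+ q r e))
    r+m : pow q (r ℕ.+ m) ≈ u * (u * t * q)
    r+m = trans (pow-+ q r m) (*-congˡ pm)

  -- s r = (-1)^r q^C(r,2)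
  s : ℕ → Carrier
  s zero = 1#
  s (suc r) = - (s r * pow q r)

  -- With weights s r the right-hand side telescopes in steps of two, since s (r+2) = s r q^(2r+1).
  B-suc : ∀ m r → let b = λ j → [ suc (m ℕ.+ m) , j ℕ.+ m ] in
    B (suc m) r ≈ b r - pow q (suc (r ℕ.+ r)) * b (suc (suc r))
  B-suc m r with r ℕ.≤? m
  ... | no r≰m =
    +-cong (trans (x-suc m r) (trans (+-congˡ (trans (*-congˡ (b-zero m<r)) (zeroʳ _))) (+-identityʳ _)))
      (-‿cong (*-congˡ (trans (x-zero (s≤s m<r)) (sym (b-zero (ℕₚ.m<n⇒m<1+n m<r))))))
    where
    m<r : m < r
    m<r = ℕₚ.≰⇒> r≰m
    b-zero : ∀ {j} → m < j → [ suc (m ℕ.+ m) , suc (j ℕ.+ m) ] ≈ 0#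
    b-zero {j} m<j = bin-> {suc (m ℕ.+ m)} {suc (j ℕ.+ m)} (s≤s (ℕₚ.+-monoˡ-< m m<j))
  ... | yes r≤m with ℕₚ.m≤n⇒∃[o]m+o≡n r≤m
  ...   | e , p = begin
    x (suc m) r - pow q (suc (r ℕ.+ r)) * x (suc m) (suc r)
      ≈⟨ +-cong (trans (x-suc m r) (+-congˡ (*-congʳ pm)))
           -- Expanding the first binomial by one Pascal rule and the second by the other gives
           -- `b (suc r)` the coefficient q^(r+m+1) both times, with opposite signs.
           (-‿cong (*-cong (*-congʳ (pow-+ q r r)) (trans (x-suc m (suc r)) (pascal-dual (suc (r ℕ.+ m)) e (index p))))) ⟩
    b r + u * (u * t) * q * b (suc r) - u * u * q * (b (suc (suc r)) + t * b (suc r))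
      ≈⟨ solve 6 (λ u t q a b c → a :+ u :* (u :* t) :* q :* b :- u :* u :* q :* (c :+ t :* b) := a :- u :* u :* q :* c) refl
           u t q (b r) (b (suc r)) (b (suc (suc r))) ⟩
    b r - u * u * q * b (suc (suc r)) ≈⟨ +-congˡ (-‿cong (*-congʳ (*-congʳ (pow-+ q r r)))) ⟨
    b r - pow q (suc (r ℕ.+ r)) * b (suc (suc r)) ∎
    where
    b : ℕ → Carrier
    b j = [ suc (m ℕ.+ m) , j ℕ.+ m ]
    u t : Carrier
    u = pow q r
    t = pow q e
    pm : pow q (suc (r ℕ.+ m)) ≈ u * (u * t) * q
    pm = *-congʳ (trans (pow-+ q r m) (*-congˡ (trans (pow-≡ q (≡.sym p)) (pow-+ q r e))))
    index : ∀ {m} → r ℕ.+ e ≡ m → suc (m ℕ.+ m) ≡ suc (r ℕ.+ m) ℕ.+ e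
    index ≡.refl = identity r e
      where
      identity : ∀ r e → suc (r ℕ.+ e ℕ.+ (r ℕ.+ e)) ≡ suc (r ℕ.+ (r ℕ.+ e)) ℕ.+ e
      identity = solve-∀

  unit-pair-suc : ∀ {m L} → suc m < L → sumBelow L (λ r → s r * B (suc m) r) ≈ 0#
  unit-pair-suc {m} {L} m<L = begin
    sumBelow L (λ r → s r * B (suc m) r) ≈⟨ sum-cong L (λ r _ → term r) ⟩
    sumBelow L (λ r → - 1# * (f (suc r) - f r)) ≈⟨ sum-*ˡ L (- 1#) _ ⟩
    - 1# * sumBelow L (λ r → f (suc r) - f r) ≈⟨ *-congˡ (sum-telescope L f) ⟩
    - 1# * (f L - f 0) ≈⟨ *-congˡ (+-cong fL (-‿cong f0)) ⟩
    - 1# * (0# - 0#) ≈⟨ solve 0 (:- con (+ 1) :* (con (+ 0) :- con (+ 0)) := con (+ 0)) refl ⟩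
    0# ∎
    where
    b f : ℕ → Carrier
    b j = [ suc (m ℕ.+ m) , j ℕ.+ m ]
    f r = s r * b r + s (suc r) * b (suc r)
    b-zero : ∀ {j} → suc m < j → b j ≈ 0#
    b-zero {j} m<j = bin-> {suc (m ℕ.+ m)} {j ℕ.+ m} (ℕₚ.+-monoˡ-< m m<j)
    fL : f L ≈ 0#
    fL = trans (+-cong (*-congˡ (b-zero m<L)) (*-congˡ (b-zero (ℕₚ.m<n⇒m<1+n m<L))))
      (solve 2 (λ a b → a :* con (+ 0) :+ b :* con (+ 0) := con (+ 0)) refl _ _)
    -- The lower boundary of the telescoping sum is `b 0 - b 1`, and these are the two equal middle
    -- coefficients [2m+1, m] and [2m+1, m+1].
    b0≈b1 : b 0 ≈ b 1
    b0≈b1 = trans (bin-≡ m (≡.sym (ℕₚ.+-suc m m))) (trans (bin-sym m (suc m)) (bin-≡ (suc m) (ℕₚ.+-suc m m)))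
    f0 : f 0 ≈ 0#
    f0 = trans (+-congʳ (*-congˡ b0≈b1))
      (solve 1 (λ b → con (+ 1) :* b :+ (:- (con (+ 1) :* con (+ 1))) :* b := con (+ 0)) refl (b 1))
    term : ∀ r → s r * B (suc m) r ≈ - 1# * (f (suc r) - f r)
    term r = trans (*-congˡ (trans (B-suc m r) (+-congˡ (-‿cong (*-congʳ (*-congʳ (pow-+ q r r)))))))
      (solve 6 (λ s u q b₀ b₁ b₂ → s :* (b₀ :- u :* u :* q :* b₂)
          := (:- con (+ 1)) :* (((:- (s :* u)) :* b₁ :+ (:- ((:- (s :* u)) :* (u :* q))) :* b₂)
                            :- (s :* b₀ :+ (:- (s :* u)) :* b₁))) refl (s r) (pow q r) q (b r) (b (suc r)) (b (suc (suc r))))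

  unit-pair-zero : ∀ {L} → 0 < L → sumBelow L (λ r → s r * B 0 r) ≈ 1#
  unit-pair-zero {L} 0<L = begin
    sumBelow L (λ r → s r * B 0 r)
      ≈⟨ sum-truncate _ 0<L (λ i 0<i → trans (*-congˡ (B-zero 0<i)) (zeroʳ _)) ⟩
    0# + 1# * (1# - 1# * q * 0#)
      ≈⟨ solve 1 (λ q → con (+ 0) :+ con (+ 1) :* (con (+ 1) :- con (+ 1) :* q :* con (+ 0)) := con (+ 1)) refl q ⟩
    1# ∎

  -- Both binomials reduce to (q)_(2m), and the remaining factors combine by 1 - q^(m+r+1) -
  -- q^(2r+1) (1 - q^(m-r)) = 1 - q^(2r+1).
  B-φ : ∀ {m} r i → r ℕ.+ i ≡ m → B m r * (φ i * φ (suc (r ℕ.+ m))) ≈ (1# - pow q (suc (r ℕ.+ r))) * φ (m ℕ.+ m)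
  B-φ {m} r i p = begin
    (x m r - w * x m (suc r)) * (φ i * (φ (r ℕ.+ m) * z))
      ≈⟨ solve 6 (λ a b w f g z → (a :- w :* b) :* (f :* (g :* z)) := a :* (g :* f) :* z :- w :* (b :* (g :* z) :* f))
           refl (x m r) (x m (suc r)) w (φ i) (φ (r ℕ.+ m)) z ⟩
    x m r * (φ (r ℕ.+ m) * φ i) * z - w * (x m (suc r) * φ (suc (r ℕ.+ m)) * φ i)
      ≈⟨ +-cong (*-congʳ x₀-φ) (-‿cong (*-congˡ (x₁-φ i p))) ⟩
    φ (m ℕ.+ m) * z - w * (φ (m ℕ.+ m) * (1# - pow q i))
      ≈⟨ +-cong (*-congˡ (+-congˡ (-‿cong (*-congˡ (trans (pow-+ q r m) (*-congˡ pm))))))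
           (-‿cong (*-congʳ (*-congʳ (pow-+ q r r)))) ⟩
    φ (m ℕ.+ m) * (1# - q * (u * (u * t))) - u * u * q * (φ (m ℕ.+ m) * (1# - t))
      ≈⟨ solve 4 (λ q u t f → f :* (con (+ 1) :- q :* (u :* (u :* t))) :- u :* u :* q :* (f :* (con (+ 1) :- t))
              := (con (+ 1) :- u :* u :* q) :* f) refl q u t _ ⟩
    (1# - u * u * q) * φ (m ℕ.+ m) ≈⟨ *-congʳ (+-congˡ (-‿cong (*-congʳ (pow-+ q r r)))) ⟨
    (1# - w) * φ (m ℕ.+ m) ∎
    where
    u t w z : Carrier
    u = pow q r
    t = pow q i
    w = pow q (suc (r ℕ.+ r))
    z = 1# - q * pow q (r ℕ.+ m)
    pm : pow q m ≈ u * t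
    pm = trans (pow-≡ q (≡.sym p)) (pow-+ q r i)
    index : ∀ {m} r i → r ℕ.+ i ≡ m → m ℕ.+ m ≡ r ℕ.+ m ℕ.+ i
    index r i ≡.refl = identity r i
      where
      identity : ∀ r i → r ℕ.+ i ℕ.+ (r ℕ.+ i) ≡ r ℕ.+ (r ℕ.+ i) ℕ.+ i
      identity = solve-∀
    x₀-φ : x m r * (φ (r ℕ.+ m) * φ i) ≈ φ (m ℕ.+ m)
    x₀-φ = trans (*-congʳ (bin-≡ (r ℕ.+ m) (index r i p)))
      (trans (bin-φ (r ℕ.+ m) i) (reflexive (≡.cong φ (≡.sym (index r i p)))))
    x₁-φ : ∀ i → r ℕ.+ i ≡ m → x m (suc r) * φ (suc (r ℕ.+ m)) * φ i ≈ φ (m ℕ.+ m) * (1# - pow q i)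
    x₁-φ zero p = trans (*-congʳ (*-congʳ (x-zero (s≤s (ℕₚ.≤-reflexive (≡.trans (≡.sym p) (ℕₚ.+-identityʳ r)))))))
      (solve 2 (λ a b → con (+ 0) :* a :* con (+ 1) := b :* (con (+ 1) :- con (+ 1))) refl _ _)
    x₁-φ (suc j) p = begin
      x m (suc r) * φ (suc (r ℕ.+ m)) * (φ j * (1# - q * pow q j))
        ≈⟨ solve 5 (λ a b c q y → a :* b :* (c :* (con (+ 1) :- q :* y)) := a :* (b :* c) :* (con (+ 1) :- y :* q)) refl _ _ _ _ _ ⟩
      x m (suc r) * (φ (suc (r ℕ.+ m)) * φ j) * (1# - pow q (suc j))
        ≈⟨ *-congʳ (trans (*-congʳ (bin-≡ (suc (r ℕ.+ m)) e)) (trans (bin-φ (suc (r ℕ.+ m)) j) (reflexive (≡.cong φ (≡.sym e))))) ⟩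
      φ (m ℕ.+ m) * (1# - pow q (suc j)) ∎
      where
      e : m ℕ.+ m ≡ suc (r ℕ.+ m) ℕ.+ j
      e = ≡.trans (index r (suc j) p) (ℕₚ.+-suc (r ℕ.+ m) j)

-- Primitive roots of unity in an integral domain of characteristic zero

record PrimitiveRootOfUnity {c ℓ : Level} (R : CommutativeRing c ℓ) : Set (c ⊔ ℓ) where
  open CommutativeRing R
  open Hseries R
  field
    no-zero-divisors : ∀ a b → a * b ≈ 0# → a ≈ 0# ⊎ b ≈ 0#
    char-zero : ∀ n → embed n ≈ 0# → n ≡ 0
    N : ℕ
    1≤N : 1 ≤ N
    q q⁻¹ : Carrier
    q*q⁻¹≈1 : q * q⁻¹ ≈ 1#
    q^N≈1 : pow q N ≈ 1#
    q^k≉1 : ∀ k → 1 ≤ k → k < N → ¬ (pow q k ≈ 1#)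

module RootOfUnity {c ℓ : Level} {R : CommutativeRing c ℓ} (ζ : PrimitiveRootOfUnity R) where
  open CommutativeRing R hiding (zero)
  open PrimitiveRootOfUnity ζ
  open Hseries R
  open IntegerCoefficients R using (solve; _:=_; _:+_; _:*_; _:-_; :-_; con)
  open FiniteSums R
  open Powers R
  open GaussianBinomials R q
  open CentralBinomials R q
  open import Algebra.Properties.Ring ring using (x∙y⁻¹≈ε⇒x≈y)
  open import Relation.Binary.Reasoning.Setoid setoid

  1≉0 : ¬ (1# ≈ 0#)
  1≉0 e with char-zero 1 (trans (+-identityˡ 1#) e)
  ... | ()

  *-nonzero : ∀ {a b} → ¬ (a ≈ 0#) → ¬ (b ≈ 0#) → ¬ (a * b ≈ 0#)
  *-nonzero a≉0 b≉0 e with no-zero-divisors _ _ e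
  ... | inj₁ a≈0 = a≉0 a≈0
  ... | inj₂ b≈0 = b≉0 b≈0

  cancelˡ : ∀ {a b d} → ¬ (a ≈ 0#) → a * b ≈ a * d → b ≈ d
  cancelˡ {a} {b} {d} a≉0 e with no-zero-divisors a (b - d)
    (trans (solve 3 (λ a b d → a :* (b :- d) := a :* b :- a :* d) refl a b d) (trans (+-congʳ e) (-‿inverseʳ _)))
  ... | inj₁ a≈0 = ⊥-elim (a≉0 a≈0)
  ... | inj₂ b-d≈0 = x∙y⁻¹≈ε⇒x≈y b d b-d≈0

  -- Primitivity enters here: it licenses every cancellation of a q-factorial.
  φ≉0 : ∀ {k} → k < N → ¬ (φ k ≈ 0#)
  φ≉0 {zero} _ = 1≉0
  φ≉0 {suc k} k<N = *-nonzero (φ≉0 (ℕₚ.<-trans (ℕₚ.n<1+n k) k<N))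
    (λ e → q^k≉1 (suc k) (s≤s z≤n) k<N (sym (trans (x∙y⁻¹≈ε⇒x≈y _ _ e) (*-comm _ _))))

  φN≈0 : ∀ {k} → k ≡ N → φ k ≈ 0#
  φN≈0 {zero} e with ≡.subst (1 ≤_) (≡.sym e) 1≤N
  ... | ()
  φN≈0 {suc k} e = trans (*-congˡ (trans (+-congˡ (-‿cong (trans (*-comm _ _) (trans (pow-≡ q e) q^N≈1)))) (-‿inverseʳ 1#))) (zeroʳ _)

  bin-N : ∀ {j} → 0 < j → j < N → [ N , j ] ≈ 0#
  bin-N {j} 0<j j<N with ℕₚ.m≤n⇒∃[o]m+o≡n (ℕₚ.<⇒≤ j<N)
  ... | i , p = cancelˡ (*-nonzero (φ≉0 j<N) (φ≉0 i<N)) (begin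
    φ j * φ i * [ N , j ] ≈⟨ *-comm _ _ ⟩
    [ N , j ] * (φ j * φ i) ≈⟨ *-congʳ (bin-≡ j (≡.sym p)) ⟩
    [ j ℕ.+ i , j ] * (φ j * φ i) ≈⟨ bin-φ j i ⟩
    φ (j ℕ.+ i) ≈⟨ φN≈0 p ⟩
    0# ≈⟨ zeroʳ _ ⟨
    φ j * φ i * 0# ∎)
    where
    i<N : i < N
    i<N = ≡.subst (i <_) p (ℕₚ.m<n+m i 0<j)

  -- The part of the q-Lucas theorem with lower index below N. Pascal's rule carries it upwards from
  -- the row N, where `bin-N` leaves only the entry at 0.
  bin-N+ : ∀ v {j} → j < N → [ N ℕ.+ v , j ] ≈ [ v , j ]
  bin-N+ v {zero} _ = trans (bin-zero (N ℕ.+ v)) (sym (bin-zero v))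
  bin-N+ zero {suc j} j<N = trans (bin-≡ (suc j) (ℕₚ.+-identityʳ N)) (bin-N (s≤s z≤n) j<N)
  bin-N+ (suc v) {suc j} j<N = trans (bin-≡ (suc j) (ℕₚ.+-suc N v))
    (+-cong (bin-N+ v (ℕₚ.<-trans (ℕₚ.n<1+n j) j<N)) (*-congˡ (bin-N+ v j<N)))

  -- The Bailey chain

  -- X m n = (q)_{2m} / ((q)_{m-n} (q)_{2n})
  X : ℕ → ℕ → Carrier
  X m n = [ m ℕ.+ n , n ℕ.+ n ] * qpoch q (pow q (suc (m ℕ.+ n))) (m ∸ n)

  P : ℕ → Carrier
  P m = qpoch q (pow q (suc m)) m

  -- The weight a^n q^(n²) of the Bailey lemma at a = q.
  μ : ℕ → Carrier
  μ n = pow q (n ℕ.* n ℕ.+ n)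

  X-zero : ∀ {m n} → m < n → X m n ≈ 0#
  X-zero {m} {n} m<n = trans (*-congʳ (bin-> (ℕₚ.+-monoˡ-< n m<n))) (zeroˡ _)

  X-self : ∀ m → X m m ≈ 1#
  X-self m = trans (*-cong (bin-self (m ℕ.+ m)) (reflexive (≡.cong (qpoch q (pow q (suc (m ℕ.+ m)))) (ℕₚ.n∸n≡0 m))))
    (*-identityˡ _)

  X-φ : ∀ {m} n e → n ℕ.+ e ≡ m → X m n * (φ (n ℕ.+ n) * φ e) ≈ φ (m ℕ.+ m)
  X-φ {m} n e p = begin
    [ m ℕ.+ n , n ℕ.+ n ] * w * (φ (n ℕ.+ n) * φ e)
      ≈⟨ solve 3 (λ a w f → a :* w :* f := (a :* f) :* w) refl _ _ _ ⟩
    [ m ℕ.+ n , n ℕ.+ n ] * (φ (n ℕ.+ n) * φ e) * w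
      ≈⟨ *-congʳ (trans (*-congʳ (bin-≡ (n ℕ.+ n) (index p))) (trans (bin-φ (n ℕ.+ n) e) (reflexive (≡.cong φ (≡.sym (index p)))))) ⟩
    φ (m ℕ.+ n) * w ≈⟨ φ-+ (m ℕ.+ n) (m ∸ n) ⟩
    φ (m ℕ.+ n ℕ.+ (m ∸ n)) ≡⟨ ≡.cong φ (≡.trans (ℕₚ.+-assoc m n (m ∸ n)) (≡.cong (m ℕ.+_) (ℕₚ.m+[n∸m]≡n n≤m))) ⟩
    φ (m ℕ.+ m) ∎
    where
    w : Carrier
    w = qpoch q (pow q (suc (m ℕ.+ n))) (m ∸ n)
    n≤m : n ≤ m
    n≤m = ≡.subst (n ≤_) p (ℕₚ.m≤m+n n e)
    index : ∀ {m} → n ℕ.+ e ≡ m → m ℕ.+ n ≡ n ℕ.+ n ℕ.+ e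
    index ≡.refl = identity n e
      where
      identity : ∀ n e → n ℕ.+ e ℕ.+ n ≡ n ℕ.+ n ℕ.+ e
      identity = solve-∀

  half< : ∀ {m} → m ℕ.+ m < N → m < N
  half< {m} = ℕₚ.≤-<-trans (ℕₚ.m≤m+n m m)

  -- Both sides stand for (q)_(2m) / ((q)_n (q)_(m-n)). This converts one level of the nested sum
  -- `F` into one Bailey step for the product of `P` and `F`.
  P-bin : ∀ {m} n → m ℕ.+ m < N → P m * [ m , n ] ≈ X m n * P n
  P-bin {m} n 2m<N with n ℕ.≤? m
  ... | no n≰m = trans (trans (*-congˡ (bin-> (ℕₚ.≰⇒> n≰m))) (zeroʳ _)) (sym (trans (*-congʳ (X-zero (ℕₚ.≰⇒> n≰m))) (zeroˡ _)))
  ... | yes n≤m with ℕₚ.m≤n⇒∃[o]m+o≡n n≤m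
  ...   | d , p = cancelˡ (*-nonzero (φ≉0 m<N) (*-nonzero (φ≉0 (ℕₚ.≤-<-trans n≤m m<N)) (φ≉0 (ℕₚ.≤-<-trans d≤m m<N)))) (begin
    φ m * (φ n * φ d) * (P m * [ m , n ])
      ≈⟨ solve 4 (λ f g p b → f :* g :* (p :* b) := (f :* p) :* (b :* g)) refl _ _ _ _ ⟩
    φ m * P m * ([ m , n ] * (φ n * φ d))
      ≈⟨ *-cong (φ-+ m m) (trans (*-congʳ (bin-≡ n (≡.sym p))) (trans (bin-φ n d) (reflexive (≡.cong φ p)))) ⟩
    φ (m ℕ.+ m) * φ m ≈⟨ *-congʳ (X-φ n d p) ⟨
    X m n * (φ (n ℕ.+ n) * φ d) * φ m ≈⟨ *-congʳ (*-congˡ (*-congʳ (φ-+ n n))) ⟨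
    X m n * (φ n * P n * φ d) * φ m
      ≈⟨ solve 5 (λ x f p g h → x :* (f :* p :* g) :* h := h :* (f :* g) :* (x :* p)) refl _ _ _ _ _ ⟩
    φ m * (φ n * φ d) * (X m n * P n) ∎)
    where
    m<N : m < N
    m<N = half< 2m<N
    d≤m : d ≤ m
    d≤m = ≡.subst (d ≤_) p (ℕₚ.m≤n+m d n)

  -- The case e = 0 is separate because (q)_{r+n+1} may vanish there: r = n = m and 2m + 1 = N.
  X-B : ∀ {m n} r i e → r ℕ.+ i ≡ n → n ℕ.+ e ≡ m → m ℕ.+ m < N →
    X m n * B n r ≈ [ i ℕ.+ e , i ] * qpoch q (pow q (suc (suc (r ℕ.+ n)))) e * B m r
  X-B {m} {n} r i zero p p′ 2m<N with ≡.trans (≡.sym (ℕₚ.+-identityʳ n)) p′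
  ... | ≡.refl = *-congʳ (trans (X-self m) (sym (trans (*-congʳ (trans (bin-≡ i (ℕₚ.+-identityʳ i)) (bin-self i))) (*-identityˡ 1#))))
  X-B {m} {n} r i (suc e′) p p′ 2m<N =
    cancelˡ (*-nonzero (*-nonzero (φ≉0 2n<N) (φ≉0 e<N)) (*-nonzero (φ≉0 i<N) (φ≉0 r+n<N))) (begin
    φ (n ℕ.+ n) * φ e * (φ i * φ (suc (r ℕ.+ n))) * (X m n * B n r)
      ≈⟨ solve 4 (λ f g x b → f :* g :* (x :* b) := (x :* f) :* (b :* g)) refl _ _ _ _ ⟩
    X m n * (φ (n ℕ.+ n) * φ e) * (B n r * (φ i * φ (suc (r ℕ.+ n))))
      ≈⟨ *-cong (X-φ n e p′) (B-φ r i p) ⟩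
    φ (m ℕ.+ m) * (w * φ (n ℕ.+ n)) ≈⟨ solve 3 (λ a w b → a :* (w :* b) := (w :* a) :* b) refl _ _ _ ⟩
    w * φ (m ℕ.+ m) * φ (n ℕ.+ n) ≈⟨ *-congʳ (B-φ r (i ℕ.+ e) r+i+e) ⟨
    B m r * (φ (i ℕ.+ e) * φ (suc (r ℕ.+ m))) * φ (n ℕ.+ n)
      ≈⟨ *-congʳ (*-congˡ (*-cong (bin-φ i e) (trans (φ-+ (suc (r ℕ.+ n)) e) (reflexive (≡.cong φ r+n+e))))) ⟨
    B m r * ([ i ℕ.+ e , i ] * (φ i * φ e) * (φ (suc (r ℕ.+ n)) * y)) * φ (n ℕ.+ n)
      ≈⟨ solve 7 (λ b g fi fe fr y fn → b :* (g :* (fi :* fe) :* (fr :* y)) :* fn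
                    := fn :* fe :* (fi :* fr) :* (g :* y :* b)) refl _ _ _ _ _ _ _ ⟩
    φ (n ℕ.+ n) * φ e * (φ i * φ (suc (r ℕ.+ n))) * ([ i ℕ.+ e , i ] * y * B m r) ∎)
    where
    e : ℕ
    e = suc e′
    w y : Carrier
    w = 1# - pow q (suc (r ℕ.+ r))
    y = qpoch q (pow q (suc (suc (r ℕ.+ n)))) e
    n<m : n < m
    n<m = ≡.subst (n <_) p′ (ℕₚ.m<m+n n (s≤s z≤n))
    2n<N : n ℕ.+ n < N
    2n<N = ℕₚ.<-trans (ℕₚ.+-mono-< n<m n<m) 2m<N
    e<N : e < N
    e<N = ℕₚ.≤-<-trans (≡.subst (e ≤_) p′ (ℕₚ.m≤n+m e n)) (half< 2m<N)
    i≤n : i ≤ n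
    i≤n = ≡.subst (i ≤_) p (ℕₚ.m≤n+m i r)
    i<N : i < N
    i<N = ℕₚ.≤-<-trans i≤n (half< 2n<N)
    r+n<N : suc (r ℕ.+ n) < N
    r+n<N = ℕₚ.≤-<-trans (ℕₚ.+-mono-≤ (ℕₚ.≤-<-trans (≡.subst (r ≤_) p (ℕₚ.m≤m+n r i)) n<m) (ℕₚ.<⇒≤ n<m)) 2m<N
    r+i+e : r ℕ.+ (i ℕ.+ e) ≡ m
    r+i+e = ≡.trans (≡.sym (ℕₚ.+-assoc r i e)) (≡.trans (≡.cong (ℕ._+ e) p) p′)
    r+n+e : suc (r ℕ.+ n) ℕ.+ e ≡ suc (r ℕ.+ m)
    r+n+e = ≡.cong suc (≡.trans (ℕₚ.+-assoc r n e) (≡.cong (r ℕ.+_) p′))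

  -- Terms with n < r or n > m vanish; after the shift n = r + i the rest is `vandermonde` with d =
  -- m - r and z = q^(2r+1).
  bailey-kernel : ∀ {m} r → m ℕ.+ m < N → sumBelow N (λ n → μ n * X m n * B n r) ≈ μ r * B m r
  bailey-kernel {m} r 2m<N with r ℕ.≤? m
  ... | no r≰m = trans (sum-zero N (λ n _ → term n)) (sym (trans (*-congˡ (B-zero (ℕₚ.≰⇒> r≰m))) (zeroʳ _)))
    where
    term : ∀ n → μ n * X m n * B n r ≈ 0#
    term n with n ℕ.≤? m
    ... | no n≰m = trans (*-congʳ (trans (*-congˡ (X-zero (ℕₚ.≰⇒> n≰m))) (zeroʳ _))) (zeroˡ _)
    ... | yes n≤m = trans (*-congˡ (B-zero (ℕₚ.≤-<-trans n≤m (ℕₚ.≰⇒> r≰m)))) (zeroʳ _)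
  ... | yes r≤m with ℕₚ.m≤n⇒∃[o]m+o≡n r≤m
  ...   | d , p = begin
    sumBelow N f
      ≈⟨ sum-truncate f (half< 2m<N) (λ n m<n → trans (*-congʳ (trans (*-congˡ (X-zero m<n)) (zeroʳ _))) (zeroˡ _)) ⟩
    sumBelow (suc m) f ≡⟨ ≡.cong (λ k → sumBelow k f) (≡.trans (≡.cong suc (≡.sym p)) (≡.sym (ℕₚ.+-suc r d))) ⟩
    sumBelow (r ℕ.+ suc d) f ≈⟨ sum-split r (suc d) f ⟩
    sumBelow r f + sumBelow (suc d) (λ i → f (r ℕ.+ i))
      ≈⟨ +-cong (sum-zero r (λ n n<r → trans (*-congˡ (B-zero n<r)) (zeroʳ _)))
                (sum-cong (suc d) (λ i i≤d → term i (ℕₚ.≤-pred i≤d))) ⟩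
    0# + sumBelow (suc d) (λ i → μ r * B m r * g i) ≈⟨ trans (+-identityˡ _) (sum-*ˡ (suc d) _ g) ⟩
    μ r * B m r * sumBelow (suc d) g ≈⟨ *-congˡ (vandermonde d z) ⟩
    μ r * B m r * 1# ≈⟨ *-identityʳ _ ⟩
    μ r * B m r ∎
    where
    z : Carrier
    z = pow q (suc (r ℕ.+ r))
    f g : ℕ → Carrier
    f n = μ n * X m n * B n r
    g i = pow z i * pow q (i ℕ.* i) * [ d , i ] * qpoch q (z * pow q (suc i)) (d ∸ i)
    exponent : ∀ r i → (r ℕ.+ i) ℕ.* (r ℕ.+ i) ℕ.+ (r ℕ.+ i) ≡ r ℕ.* r ℕ.+ r ℕ.+ (i ℕ.* suc (r ℕ.+ r) ℕ.+ i ℕ.* i)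
    exponent = solve-∀
    exponent′ : ∀ r i → suc (r ℕ.+ r) ℕ.+ suc i ≡ suc (suc (r ℕ.+ (r ℕ.+ i)))
    exponent′ = solve-∀
    term : ∀ i → i ≤ d → f (r ℕ.+ i) ≈ μ r * B m r * g i
    term i i≤d = begin
      μ (r ℕ.+ i) * X m (r ℕ.+ i) * B (r ℕ.+ i) r ≈⟨ *-assoc _ _ _ ⟩
      μ (r ℕ.+ i) * (X m (r ℕ.+ i) * B (r ℕ.+ i) r) ≈⟨ *-congˡ (X-B r i (d ∸ i) ≡.refl p′ 2m<N) ⟩
      μ (r ℕ.+ i) * ([ i ℕ.+ (d ∸ i) , i ] * qpoch q (pow q (suc (suc (r ℕ.+ (r ℕ.+ i))))) (d ∸ i) * B m r)
        ≈⟨ *-cong (trans (pow-split q (r ℕ.* r ℕ.+ r) _ (exponent r i))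
                    (*-congˡ (trans (pow-+ q (i ℕ.* suc (r ℕ.+ r)) (i ℕ.* i)) (*-congʳ (pow-* q (suc (r ℕ.+ r)) i)))))
             (*-congʳ (*-cong (bin-≡ i (ℕₚ.m+[n∸m]≡n i≤d))
               (qpoch-cong (d ∸ i) (trans (pow-≡ q (≡.sym (exponent′ r i))) (pow-+ q (suc (r ℕ.+ r)) (suc i)))))) ⟩
      μ r * (pow z i * pow q (i ℕ.* i)) * ([ d , i ] * qpoch q (z * pow q (suc i)) (d ∸ i) * B m r)
        ≈⟨ solve 6 (λ m z s b y B → m :* (z :* s) :* (b :* y :* B) := m :* B :* (z :* s :* b :* y)) refl _ _ _ _ _ _ ⟩
      μ r * B m r * g i ∎
      where
      p′ : r ℕ.+ i ℕ.+ (d ∸ i) ≡ m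
      p′ = ≡.trans (ℕₚ.+-assoc r i (d ∸ i)) (≡.trans (≡.cong (r ℕ.+_) (ℕₚ.m+[n∸m]≡n i≤d)) p)

  -- The expansion of `g` is requested only where 2n < N. That suffices, since `X m n` vanishes for
  -- n > m and n ≤ m gives 2n ≤ 2m < N.
  bailey-lemma : ∀ (a g : ℕ → Carrier) →
    (∀ n → n ℕ.+ n < N → g n ≈ sumBelow N (λ r → a r * B n r)) →
    ∀ {m} → m ℕ.+ m < N →
    sumBelow N (λ n → μ n * X m n * g n) ≈ sumBelow N (λ r → a r * μ r * B m r)
  bailey-lemma a g expand {m} 2m<N = begin
    sumBelow N (λ n → μ n * X m n * g n) ≈⟨ sum-cong N (λ n _ → term n) ⟩
    sumBelow N (λ n → sumBelow N (λ r → a r * (μ n * X m n * B n r))) ≈⟨ sum-swap N N _ ⟩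
    sumBelow N (λ r → sumBelow N (λ n → a r * (μ n * X m n * B n r))) ≈⟨ sum-cong N (λ r _ → sum-*ˡ N (a r) _) ⟩
    sumBelow N (λ r → a r * sumBelow N (λ n → μ n * X m n * B n r))
      ≈⟨ sum-cong N (λ r _ → trans (*-congˡ (bailey-kernel r 2m<N)) (sym (*-assoc _ _ _))) ⟩
    sumBelow N (λ r → a r * μ r * B m r) ∎
    where
    term : ∀ n → μ n * X m n * g n ≈ sumBelow N (λ r → a r * (μ n * X m n * B n r))
    term n with n ℕ.≤? m
    ... | no n≰m = trans (vanish (g n)) (sym (sum-zero N (λ r _ → trans (*-congˡ (vanish (B n r))) (zeroʳ _))))
      where
      vanish : ∀ y → μ n * X m n * y ≈ 0#
      vanish y = trans (*-congʳ (trans (*-congˡ (X-zero (ℕₚ.≰⇒> n≰m))) (zeroʳ _))) (zeroˡ _)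
    ... | yes n≤m = trans (*-congˡ (expand n (ℕₚ.≤-<-trans (ℕₚ.+-mono-≤ n≤m n≤m) 2m<N)))
      (trans (sym (sum-*ˡ N _ _)) (sum-cong N (λ r _ → solve 3 (λ x a b → x :* (a :* b) := a :* (x :* b)) refl _ _ _)))

  a : ℕ → ℕ → Carrier
  a j r = s r * pow (μ r) j

  -- Already F = 1 costs one Bailey step, because (q^(m+1))_m is `X m 0`, the transform of the unit
  -- sequence `δ`; hence the exponent `suc j` of `μ` from the start. `P-bin` supplies each further
  -- step.
  F-expansion : ∀ j {m} → m ℕ.+ m < N → P m * F q (suc j) m ≈ sumBelow N (λ r → a (suc j) r * B m r)
  F-expansion zero {m} 2m<N = begin
    P m * 1# ≈⟨ *-identityʳ _ ⟩
    P m ≡⟨ ≡.cong (λ k → qpoch q (pow q (suc k)) m) (≡.sym (ℕₚ.+-identityʳ m)) ⟩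
    qpoch q (pow q (suc (m ℕ.+ 0))) m ≈⟨ trans (*-congʳ (bin-zero (m ℕ.+ 0))) (*-identityˡ _) ⟨
    X m 0 ≈⟨ solve 1 (λ x → con (+ 0) :+ con (+ 1) :* x :* con (+ 1) := x) refl _ ⟨
    sumBelow 1 (λ n → μ n * X m n * δ n) ≈⟨ sum-truncate _ 1≤N (λ { (suc n) _ → zeroʳ _ }) ⟨
    sumBelow N (λ n → μ n * X m n * δ n) ≈⟨ bailey-lemma s δ unit-pair 2m<N ⟩
    sumBelow N (λ r → s r * μ r * B m r) ≈⟨ sum-cong N (λ r _ → *-congʳ (*-congˡ (*-identityˡ _))) ⟨
    sumBelow N (λ r → a 1 r * B m r) ∎
    where
    δ : ℕ → Carrier
    δ zero = 1#
    δ (suc n) = 0#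
    unit-pair : ∀ n → n ℕ.+ n < N → δ n ≈ sumBelow N (λ r → s r * B n r)
    unit-pair zero _ = sym (unit-pair-zero 1≤N)
    unit-pair (suc n) 2n<N = sym (unit-pair-suc (half< 2n<N))
  F-expansion (suc j) {m} 2m<N = begin
    P m * sumTo m (λ n → μ n * [ m , n ] * F q (suc j) n)
      ≈⟨ *-congˡ (trans (sumTo≈sumBelow m _) (sym (sum-truncate _ (half< 2m<N)
           (λ n m<n → trans (*-congʳ (trans (*-congˡ (bin-> m<n)) (zeroʳ _))) (zeroˡ _))))) ⟩
    P m * sumBelow N (λ n → μ n * [ m , n ] * F q (suc j) n) ≈⟨ sum-*ˡ N (P m) _ ⟨
    sumBelow N (λ n → P m * (μ n * [ m , n ] * F q (suc j) n)) ≈⟨ sum-cong N (λ n _ → term n) ⟩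
    sumBelow N (λ n → μ n * X m n * (P n * F q (suc j) n))
      ≈⟨ bailey-lemma (a (suc j)) (λ n → P n * F q (suc j) n) (λ n → F-expansion j) 2m<N ⟩
    sumBelow N (λ r → a (suc j) r * μ r * B m r) ≈⟨ sum-cong N (λ r _ → *-congʳ (*-assoc _ _ _)) ⟩
    sumBelow N (λ r → a (suc (suc j)) r * B m r) ∎
    where
    term : ∀ n → P m * (μ n * [ m , n ] * F q (suc j) n) ≈ μ n * X m n * (P n * F q (suc j) n)
    term n = begin
      P m * (μ n * [ m , n ] * F q (suc j) n)
        ≈⟨ solve 4 (λ p m b f → p :* (m :* b :* f) := m :* (p :* b) :* f) refl _ _ _ _ ⟩
      μ n * (P m * [ m , n ]) * F q (suc j) n ≈⟨ *-congʳ (*-congˡ (P-bin n 2m<N)) ⟩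
      μ n * (X m n * P n) * F q (suc j) n
        ≈⟨ solve 4 (λ m x p f → m :* (x :* p) :* f := m :* x :* (p :* f)) refl _ _ _ _ ⟩
      μ n * X m n * (P n * F q (suc j) n) ∎

  -- Reflection r ↔ N - 1 - r

  pow-period : ∀ u → pow q (u ℕ.* N) ≈ 1#
  pow-period u = trans (pow-* q N u) (trans (pow-cong u q^N≈1) (pow-1 u))

  pow-mod : ∀ d e u v → d ℕ.+ u ℕ.* N ≡ e ℕ.+ v ℕ.* N → pow q d ≈ pow q e
  pow-mod d e u v p = begin
    pow q d ≈⟨ *-identityʳ _ ⟨
    pow q d * 1# ≈⟨ *-congˡ (pow-period u) ⟨
    pow q d * pow q (u ℕ.* N) ≈⟨ pow-+ q d (u ℕ.* N) ⟨
    pow q (d ℕ.+ u ℕ.* N) ≈⟨ pow-split q e (v ℕ.* N) p ⟩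
    pow q e * pow q (v ℕ.* N) ≈⟨ *-congˡ (pow-period v) ⟩
    pow q e * 1# ≈⟨ *-identityʳ _ ⟩
    pow q e ∎

  μ-reflect : ∀ r r′ → suc (r ℕ.+ r′) ≡ N → μ r ≈ μ r′
  μ-reflect r r′ p = pow-mod (r ℕ.* r ℕ.+ r) (r′ ℕ.* r′ ℕ.+ r′) r′ r (index p)
    where
    index : ∀ {n} → suc (r ℕ.+ r′) ≡ n → r ℕ.* r ℕ.+ r ℕ.+ r′ ℕ.* n ≡ r′ ℕ.* r′ ℕ.+ r′ ℕ.+ r ℕ.* n
    index ≡.refl = identity r r′
      where
      identity : ∀ r r′ → r ℕ.* r ℕ.+ r ℕ.+ r′ ℕ.* suc (r ℕ.+ r′) ≡ r′ ℕ.* r′ ℕ.+ r′ ℕ.+ r ℕ.* suc (r ℕ.+ r′)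
      identity = solve-∀

  -- h r = (-1)^r q^C(r+1,2)
  h : ℕ → Carrier
  h r = s r * pow q r

  -- By [N, r+1] = 0 and Pascal's rule, h r and [N-1, r] satisfy reciprocal recurrences; so no square root of q^N is
  -- needed for even N.
  h-bin : ∀ r r′ → suc (r ℕ.+ r′) ≡ N → h r * [ r ℕ.+ r′ , r ] ≈ 1#
  h-bin zero r′ p = trans (*-congˡ (bin-zero r′)) (solve 0 (con (+ 1) :* con (+ 1) :* con (+ 1) := con (+ 1)) refl)
  h-bin (suc r) r′ p = begin
    - (s r * pow q r) * (pow q r * q) * [ suc (r ℕ.+ r′) , suc r ]
      ≈⟨ solve 5 (λ s u q b d → (:- (s :* u)) :* (u :* q) :* b := s :* u :* d :- s :* u :* (d :+ u :* q :* b))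
           refl (s r) (pow q r) q [ suc (r ℕ.+ r′) , suc r ] [ suc (r ℕ.+ r′) , r ] ⟩
    h r * [ suc (r ℕ.+ r′) , r ] - h r * ([ suc (r ℕ.+ r′) , r ] + pow q (suc r) * [ suc (r ℕ.+ r′) , suc r ])
      ≈⟨ +-cong (trans (*-congˡ (bin-≡ r (≡.sym (ℕₚ.+-suc r r′)))) (h-bin r (suc r′) (≡.trans (≡.cong suc (ℕₚ.+-suc r r′)) p)))
                (-‿cong (trans (*-congˡ (trans (bin-≡ (suc r) p) (bin-N (s≤s z≤n) r<N))) (zeroʳ _))) ⟩
    1# - 0# ≈⟨ solve 0 (con (+ 1) :- con (+ 0) := con (+ 1)) refl ⟩
    1# ∎
    where
    r<N : suc r < N
    r<N = ≡.subst (suc r <_) p (s≤s (s≤s (ℕₚ.m≤m+n r r′)))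

  -- By `h-bin` and symmetry, `h r` and `h r′` are both inverse to the same binomial coefficient
  -- with upper index N - 1.
  h-reflect : ∀ r r′ → suc (r ℕ.+ r′) ≡ N → h r ≈ h r′
  h-reflect r r′ p = begin
    h r ≈⟨ *-identityʳ _ ⟨
    h r * 1# ≈⟨ *-congˡ (h-bin r′ r (≡.trans (≡.cong suc (ℕₚ.+-comm r′ r)) p)) ⟨
    h r * (h r′ * [ r′ ℕ.+ r , r′ ]) ≈⟨ *-congˡ (*-congˡ (trans (bin-sym r′ r) (bin-≡ r (ℕₚ.+-comm r′ r)))) ⟩
    h r * (h r′ * [ r ℕ.+ r′ , r ]) ≈⟨ solve 3 (λ a b d → a :* (b :* d) := b :* (a :* d)) refl _ _ _ ⟩
    h r′ * (h r * [ r ℕ.+ r′ , r ]) ≈⟨ *-congˡ (h-bin r r′ p) ⟩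
    h r′ * 1# ≈⟨ *-identityʳ _ ⟩
    h r′ ∎

  a-reflect : ∀ j r r′ → suc (r ℕ.+ r′) ≡ N → a j r′ ≈ a j r * pow q (suc (r ℕ.+ r))
  a-reflect j r r′ p = begin
    s r′ * pow (μ r′) j ≈⟨ *-cong s′ (pow-cong j (sym (μ-reflect r r′ p))) ⟩
    s r * pow q r * pow q (suc r) * pow (μ r) j
      ≈⟨ solve 4 (λ s u q m → s :* u :* (u :* q) :* m := s :* m :* (u :* u :* q)) refl _ _ _ _ ⟩
    s r * pow (μ r) j * (pow q r * pow q r * q) ≈⟨ *-congˡ (*-congʳ (pow-+ q r r)) ⟨
    a j r * pow q (suc (r ℕ.+ r)) ∎
    where
    s′ : s r′ ≈ s r * pow q r * pow q (suc r)
    s′ = begin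
      s r′ ≈⟨ *-identityʳ _ ⟨
      -- Since r′ + (r + 1) = N, the factor q^(r+1) undoes the q^(r′) that turns `s r′` into `h r′`.
      s r′ * 1# ≈⟨ *-congˡ (trans (pow-≡ q (≡.trans (ℕₚ.+-suc r′ r) (≡.trans (≡.cong suc (ℕₚ.+-comm r′ r)) p))) q^N≈1) ⟨
      s r′ * pow q (r′ ℕ.+ suc r) ≈⟨ trans (*-congˡ (pow-+ q r′ (suc r))) (sym (*-assoc _ _ _)) ⟩
      h r′ * pow q (suc r) ≈⟨ *-congʳ (h-reflect r r′ p) ⟨
      h r * pow q (suc r) ∎

  module _ {m : ℕ} (m<N : m < N) (N≤2m : N ≤ m ℕ.+ m) where

    -- By symmetry the lower index becomes d = m - t, which is below N, so `bin-N+` strips N from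
    -- the upper index 2m = N + v.
    x-lucas : ∀ {v t} d → N ℕ.+ v ≡ m ℕ.+ m → t ℕ.+ d ≡ m → x m t ≈ [ v , d ]
    x-lucas {v} {t} d p e = begin
      [ m ℕ.+ m , t ℕ.+ m ] ≈⟨ bin-≡ (t ℕ.+ m) (index e) ⟩
      [ t ℕ.+ m ℕ.+ d , t ℕ.+ m ] ≈⟨ bin-sym (t ℕ.+ m) d ⟩
      [ t ℕ.+ m ℕ.+ d , d ] ≈⟨ bin-≡ d (≡.trans (≡.sym (index e)) (≡.sym p)) ⟩
      [ N ℕ.+ v , d ] ≈⟨ bin-N+ v (ℕₚ.≤-<-trans (≡.subst (d ≤_) e (ℕₚ.m≤n+m d t)) m<N) ⟩
      [ v , d ] ∎
      where
      index : ∀ {m} → t ℕ.+ d ≡ m → m ℕ.+ m ≡ t ℕ.+ m ℕ.+ d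
      index ≡.refl = identity t d
        where
        identity : ∀ t d → t ℕ.+ d ℕ.+ (t ℕ.+ d) ≡ t ℕ.+ (t ℕ.+ d) ℕ.+ d
        identity = solve-∀

    -- If t′ ≤ m, then v = 2m - N = (m - t) + (m - t′), so the reflection is the symmetry of the
    -- reduced binomial [v, m - t]. If t′ > m, then v < m - t and both sides are zero.
    x-reflect-≤ : ∀ {t t′} → t ≤ m → t ℕ.+ t′ ≡ N → x m t′ ≈ x m t
    x-reflect-≤ {t} {t′} t≤m t+t′ with ℕₚ.m≤n⇒∃[o]m+o≡n t≤m | ℕₚ.m≤n⇒∃[o]m+o≡n N≤2m | t′ ℕ.≤? m
    ... | d , e | v , p | no t′≰m = trans (x-zero t′>m) (sym (trans (x-lucas d p e) (bin-> v<d)))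
      where
      t′>m : m < t′
      t′>m = ℕₚ.≰⇒> t′≰m
      v<d : v < d
      v<d = ℕₚ.+-cancelˡ-< (t ℕ.+ m) v d (ℕₚ.<-≤-trans
        (ℕₚ.+-monoˡ-< v (ℕₚ.+-monoʳ-< t t′>m))
        (ℕₚ.≤-reflexive (≡.trans (≡.cong (ℕ._+ v) t+t′) (≡.trans p (≡.trans (≡.cong (ℕ._+ m) (≡.sym e))
           (≡.trans (ℕₚ.+-assoc t d m) (≡.trans (≡.cong (t ℕ.+_) (ℕₚ.+-comm d m)) (≡.sym (ℕₚ.+-assoc t m d)))))))))
    ... | d , e | v , p | yes t′≤m with ℕₚ.m≤n⇒∃[o]m+o≡n t′≤m
    ...   | d′ , e′ = begin
      x m t′ ≈⟨ x-lucas d′ p e′ ⟩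
      [ v , d′ ] ≈⟨ bin-≡ d′ v≡ ⟩
      [ d ℕ.+ d′ , d′ ] ≈⟨ bin-sym d d′ ⟨
      [ d ℕ.+ d′ , d ] ≈⟨ bin-≡ d v≡ ⟨
      [ v , d ] ≈⟨ x-lucas d p e ⟨
      x m t ∎
      where
      identity : ∀ t d t′ d′ → t ℕ.+ d ℕ.+ (t′ ℕ.+ d′) ≡ t ℕ.+ t′ ℕ.+ (d ℕ.+ d′)
      identity = solve-∀
      v≡ : v ≡ d ℕ.+ d′
      v≡ = ℕₚ.+-cancelˡ-≡ N v (d ℕ.+ d′) (≡.trans p (≡.trans (≡.cong₂ ℕ._+_ (≡.sym e) (≡.sym e′))
        (≡.trans (identity t d t′ d′) (≡.cong (ℕ._+ (d ℕ.+ d′)) t+t′))))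

    x-reflect : ∀ {t t′} → t ℕ.+ t′ ≡ N → x m t′ ≈ x m t
    x-reflect {t} {t′} p with t ℕ.≤? m | t′ ℕ.≤? m
    ... | yes t≤m | _ = x-reflect-≤ t≤m p
    ... | no _ | yes t′≤m = sym (x-reflect-≤ t′≤m (≡.trans (ℕₚ.+-comm t′ t) p))
    ... | no t≰m | no t′≰m = trans (x-zero (ℕₚ.≰⇒> t′≰m)) (sym (x-zero (ℕₚ.≰⇒> t≰m)))

    -- As r′ + (r + 1) = (r′ + 1) + r = N, reflection swaps the two terms of `B`; their weights
    -- q^(2r+1) and q^(2r′+1) multiply to q^(2N) = 1.
    B-reflect : ∀ r r′ → suc (r ℕ.+ r′) ≡ N → pow q (suc (r ℕ.+ r)) * B m r′ ≈ - B m r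
    B-reflect r r′ p = begin
      w * (x m r′ - pow q (suc (r′ ℕ.+ r′)) * x m (suc r′))
        ≈⟨ *-congˡ (+-cong (x-reflect {suc r} p) (-‿cong (*-congˡ (x-reflect {r} (≡.trans (ℕₚ.+-suc r r′) p))))) ⟩
      w * (x m (suc r) - pow q (suc (r′ ℕ.+ r′)) * x m r)
        ≈⟨ solve 4 (λ w a v b → w :* (a :- v :* b) := w :* a :- (w :* v) :* b) refl _ _ _ _ ⟩
      w * x m (suc r) - w * pow q (suc (r′ ℕ.+ r′)) * x m r
        ≈⟨ +-congˡ (-‿cong (*-congʳ (trans (sym (pow-+ q (suc (r ℕ.+ r)) (suc (r′ ℕ.+ r′)))) (pow-mod (suc (r ℕ.+ r) ℕ.+ suc (r′ ℕ.+ r′)) 0 0 2 (index p))))) ⟩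
      w * x m (suc r) - 1# * x m r ≈⟨ solve 3 (λ w a b → w :* a :- con (+ 1) :* b := :- (b :- w :* a)) refl _ _ _ ⟩
      - (x m r - w * x m (suc r)) ∎
      where
      w : Carrier
      w = pow q (suc (r ℕ.+ r))
      index : ∀ {n} → suc (r ℕ.+ r′) ≡ n → suc (r ℕ.+ r) ℕ.+ suc (r′ ℕ.+ r′) ℕ.+ 0 ≡ 2 ℕ.* n
      index ≡.refl = identity r r′
        where
        identity : ∀ r r′ → suc (r ℕ.+ r) ℕ.+ suc (r′ ℕ.+ r′) ℕ.+ 0 ≡ 2 ℕ.* suc (r ℕ.+ r′)
        identity = solve-∀

    -- The factor q^(2r+1) from `a-reflect` meets the one in `B-reflect`, leaving only a sign. The
    -- sum equals its own negative, and 2 is nonzero in characteristic zero.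
    B-sum-vanishes : ∀ j → sumBelow N (λ r → a j r * B m r) ≈ 0#
    B-sum-vanishes j with no-zero-divisors (1# + 1#) T (begin
        (1# + 1#) * T ≈⟨ solve 1 (λ T → (con (+ 1) :+ con (+ 1)) :* T := T :+ T) refl T ⟩
        T + T ≈⟨ +-congˡ T≈-T ⟩
        T - T ≈⟨ -‿inverseʳ T ⟩
        0# ∎)
      where
      T : Carrier
      T = sumBelow N (λ r → a j r * B m r)
      T≈-T : T ≈ - T
      T≈-T = begin
        T ≈⟨ sum-reverse N _ _ (λ r r′ p → begin
             a j r * B m r
               ≈⟨ *-congʳ (a-reflect j r′ r (≡.trans (≡.cong suc (ℕₚ.+-comm r′ r)) p)) ⟩
             a j r′ * pow q (suc (r′ ℕ.+ r′)) * B m r ≈⟨ *-assoc _ _ _ ⟩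
             a j r′ * (pow q (suc (r′ ℕ.+ r′)) * B m r)
               ≈⟨ *-congˡ (B-reflect r′ r (≡.trans (≡.cong suc (ℕₚ.+-comm r′ r)) p)) ⟩
             a j r′ * - B m r′ ≈⟨ solve 2 (λ a b → a :* (:- b) := (:- con (+ 1)) :* (a :* b)) refl _ _ ⟩
             - 1# * (a j r′ * B m r′) ∎) ⟩
        sumBelow N (λ r → - 1# * (a j r * B m r)) ≈⟨ sum-*ˡ N (- 1#) _ ⟩
        - 1# * T ≈⟨ solve 1 (λ T → (:- con (+ 1)) :* T := :- T) refl T ⟩
        - T ∎
    ... | inj₂ T≈0 = T≈0
    ... | inj₁ 2≈0 with char-zero 2 (trans (+-congʳ (+-identityˡ 1#)) 2≈0)
    ...   | ()

  -- The sums U_r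

  q⁻¹-pow : ∀ e → pow q⁻¹ e * pow q e ≈ 1#
  q⁻¹-pow e = trans (sym (pow-distrib q⁻¹ q e)) (trans (pow-cong e (trans (*-comm q⁻¹ q) q*q⁻¹≈1)) (pow-1 e))

  q⁻¹-period : pow q⁻¹ (N ℕ.* N) ≈ 1#
  q⁻¹-period = trans (sym (*-identityʳ _)) (trans (*-congˡ (sym (pow-period N))) (q⁻¹-pow (N ℕ.* N)))

  U : ℕ → Carrier
  U r = sumBelow N (λ m → pow q⁻¹ (m ℕ.* m ℕ.+ m) * x m r)

  U-zero : ∀ {r} → N ≤ r → U r ≈ 0#
  U-zero N≤r = sum-zero N (λ m m<N → trans (*-congˡ (x-zero (ℕₚ.<-≤-trans m<N N≤r))) (zeroʳ _))

  -- This is `x-telescope` divided by q^((m+1)²) and summed over m < N. The lower end contributes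
  -- nothing because `x 0 1` and `x 0 2` vanish; at the upper end q^(-N²) = 1.
  U-rec : ∀ r → U r ≈ pow q (suc (suc (suc (r ℕ.+ r)))) * U (suc (suc (suc r)))
                      + pow q (suc r) * (x N (suc r) - x N (suc (suc r)))
  U-rec r = begin
    U r ≈⟨ sum-cong N (λ m _ → term m) ⟩
    sumBelow N (λ m → w * (κ m * x m (suc (suc (suc r)))) + pow q (suc r) * (Y (suc m) - Y m)) ≈⟨ sum-+ N _ _ ⟩
    sumBelow N (λ m → w * (κ m * x m (suc (suc (suc r))))) + sumBelow N (λ m → pow q (suc r) * (Y (suc m) - Y m))
      ≈⟨ +-cong (sum-*ˡ N w _) (trans (sum-*ˡ N _ _) (*-congˡ (sum-telescope N Y))) ⟩
    w * U (suc (suc (suc r))) + pow q (suc r) * (Y N - Y 0)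
      ≈⟨ +-congˡ (*-congˡ (+-cong (trans (*-congʳ q⁻¹-period) (*-identityˡ _))
           (-‿cong (solve 0 (con (+ 1) :* (con (+ 0) :- con (+ 0)) := con (+ 0)) refl)))) ⟩
    w * U (suc (suc (suc r))) + pow q (suc r) * (x N (suc r) - x N (suc (suc r)) - 0#)
      ≈⟨ +-congˡ (*-congˡ (solve 1 (λ a → a :- con (+ 0) := a) refl _)) ⟩
    w * U (suc (suc (suc r))) + pow q (suc r) * (x N (suc r) - x N (suc (suc r))) ∎
    where
    w : Carrier
    w = pow q (suc (suc (suc (r ℕ.+ r))))
    κ Y : ℕ → Carrier
    κ m = pow q⁻¹ (m ℕ.* m ℕ.+ m)
    Y m = pow q⁻¹ (m ℕ.* m) * (x m (suc r) - x m (suc (suc r)))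
    exponent : ∀ m → m ℕ.* m ℕ.+ m ℕ.+ suc m ≡ suc m ℕ.* suc m
    exponent = solve-∀
    exponent′ : ∀ m → suc m ℕ.* suc m ≡ m ℕ.* m ℕ.+ suc (m ℕ.+ m)
    exponent′ = solve-∀
    term : ∀ m → κ m * x m r ≈ w * (κ m * x m (suc (suc (suc r)))) + pow q (suc r) * (Y (suc m) - Y m)
    term m = begin
      κ m * x m r
        ≈⟨ solve 4 (λ k w a b → k :* a := w :* (k :* b) :+ k :* con (+ 1) :* (a :- w :* b)) refl
             (κ m) w (x m r) (x m (suc (suc (suc r)))) ⟩
      w * (κ m * x m (suc (suc (suc r)))) + κ m * 1# * (x m r - w * x m (suc (suc (suc r))))
        ≈⟨ +-congˡ (*-congʳ (*-congˡ (q⁻¹-pow (suc m)))) ⟨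
      w * (κ m * x m (suc (suc (suc r)))) + κ m * (pow q⁻¹ (suc m) * pow q (suc m)) * (x m r - w * x m (suc (suc (suc r))))
        ≈⟨ +-congˡ (trans (solve 4 (λ a b c d → a :* (b :* c) :* d := (a :* b) :* (c :* d)) refl _ _ _ _)
             (*-cong (sym (pow-split q⁻¹ (m ℕ.* m ℕ.+ m) (suc m) (≡.sym (exponent m)))) (x-telescope m r))) ⟩
      w * (κ m * x m (suc (suc (suc r))))
        + pow q⁻¹ (suc m ℕ.* suc m) * (pow q (suc r) * (D′ - pow q (suc (m ℕ.+ m)) * D))
        ≈⟨ +-congˡ (solve 5 (λ k u d′ v d → k :* (u :* (d′ :- v :* d)) := u :* (k :* d′ :- k :* v :* d)) refl _ _ _ _ _) ⟩
      w * (κ m * x m (suc (suc (suc r))))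
        + pow q (suc r) * (Y (suc m) - pow q⁻¹ (suc m ℕ.* suc m) * pow q (suc (m ℕ.+ m)) * D)
        ≈⟨ +-congˡ (*-congˡ (+-congˡ (-‿cong (*-congʳ (trans (*-congʳ (pow-split q⁻¹ (m ℕ.* m) (suc (m ℕ.+ m)) (exponent′ m)))
             (trans (*-assoc _ _ _) (trans (*-congˡ (q⁻¹-pow (suc (m ℕ.+ m)))) (*-identityʳ _)))))))) ⟩
      w * (κ m * x m (suc (suc (suc r)))) + pow q (suc r) * (Y (suc m) - Y m) ∎
      where
      D D′ : Carrier
      D = x m (suc r) - x m (suc (suc r))
      D′ = x (suc m) (suc r) - x (suc m) (suc (suc r))

  -- By symmetry and `bin-N+` this is [2N, i] = [N, i] with 0 < i < N.
  x-N : ∀ j i → 0 < j → 0 < i → j ℕ.+ i ≡ N → x N j ≈ 0#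
  x-N j i 0<j 0<i p = begin
    [ N ℕ.+ N , j ℕ.+ N ] ≈⟨ bin-≡ (j ℕ.+ N) index ⟩
    [ j ℕ.+ N ℕ.+ i , j ℕ.+ N ] ≈⟨ bin-sym (j ℕ.+ N) i ⟩
    [ j ℕ.+ N ℕ.+ i , i ] ≈⟨ bin-≡ i index ⟨
    [ N ℕ.+ N , i ] ≈⟨ bin-N+ N i<N ⟩
    [ N , i ] ≈⟨ bin-N 0<i i<N ⟩
    0# ∎
    where
    i<N : i < N
    i<N = ≡.subst (i <_) p (ℕₚ.m<n+m i 0<j)
    index : N ℕ.+ N ≡ j ℕ.+ N ℕ.+ i
    index = ≡.trans (≡.cong (ℕ._+ N) (≡.sym p)) (≡.trans (ℕₚ.+-assoc j i N)
      (≡.trans (≡.cong (j ℕ.+_) (ℕₚ.+-comm i N)) (≡.sym (ℕₚ.+-assoc j N i))))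

  -- The factor q^(r²) makes a plain difference out of what `B` produces: q^(r²) (U_r - q^(2r+1)
  -- U_(r+1)) = W_r - W_(r+1).
  W : ℕ → Carrier
  W r = pow q (r ℕ.* r) * U r

  -- S k = α_0 + ... + α_{k-1}
  S : ℕ → Carrier
  S 0 = 0#
  S 1 = 1#
  S 2 = - pow q 2
  S (suc (suc (suc k))) = pow q (4 ℕ.* k ℕ.+ 6) * S k

  -- By `U-rec`, passing from r + 3 to r multiplies `W` by q^(-4r-6), which is q^(4k+6) when r + 3 =
  -- N - k. The initial values come from the boundary term: for k = 1 and k = 2 the coefficient
  -- `x N N` = 1 enters with sign plus and minus respectively.
  W-S : ∀ k r → r ℕ.+ k ≡ N → W r ≈ q * S k
  W-S 0 r p = trans (*-congˡ (U-zero (ℕₚ.≤-reflexive (≡.trans (≡.sym p) (ℕₚ.+-identityʳ r))))) (trans (zeroʳ _) (sym (zeroʳ _)))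
  W-S 1 r p = begin
    pow q (r ℕ.* r) * U r ≈⟨ *-congˡ (U-rec r) ⟩
    pow q (r ℕ.* r) * (w * U (suc (suc (suc r))) + pow q (suc r) * (x N (suc r) - x N (suc (suc r))))
      ≈⟨ *-congˡ (+-cong (*-congˡ (U-zero (ℕₚ.≤-trans (ℕₚ.≤-reflexive N≡) (ℕₚ.m≤n+m (suc r) 2))))
           (*-congˡ (+-cong (trans (reflexive (≡.cong (x N) (≡.sym N≡))) (x-top N))
             (-‿cong (x-zero (ℕₚ.≤-reflexive (≡.cong suc N≡))))))) ⟩
    pow q (r ℕ.* r) * (w * 0# + pow q (suc r) * (1# - 0#))
      ≈⟨ solve 3 (λ a w b → a :* (w :* con (+ 0) :+ b :* (con (+ 1) :- con (+ 0))) := a :* b) refl _ _ _ ⟩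
    pow q (r ℕ.* r) * pow q (suc r) ≈⟨ pow-+ q (r ℕ.* r) (suc r) ⟨
    pow q (r ℕ.* r ℕ.+ suc r) ≈⟨ pow-mod (r ℕ.* r ℕ.+ suc r) 1 0 r (index N≡) ⟩
    1# * q ≈⟨ *-comm _ _ ⟩
    q * 1# ∎
    where
    w : Carrier
    w = pow q (suc (suc (suc (r ℕ.+ r))))
    N≡ : N ≡ suc r
    N≡ = ≡.trans (≡.sym p) (ℕₚ.+-comm r 1)
    index : ∀ {n} → n ≡ suc r → r ℕ.* r ℕ.+ suc r ℕ.+ 0 ≡ 1 ℕ.+ r ℕ.* n
    index ≡.refl = identity r
      where
      identity : ∀ r → r ℕ.* r ℕ.+ suc r ℕ.+ 0 ≡ 1 ℕ.+ r ℕ.* suc r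
      identity = solve-∀
  W-S 2 r p = begin
    pow q (r ℕ.* r) * U r ≈⟨ *-congˡ (U-rec r) ⟩
    pow q (r ℕ.* r) * (w * U (suc (suc (suc r))) + pow q (suc r) * (x N (suc r) - x N (suc (suc r))))
      ≈⟨ *-congˡ (+-cong (*-congˡ (U-zero (ℕₚ.≤-trans (ℕₚ.≤-reflexive N≡) (ℕₚ.m≤n+m (suc (suc r)) 1))))
           (*-congˡ (+-cong (x-N (suc r) 1 (s≤s z≤n) (s≤s z≤n) (≡.trans (≡.sym (ℕₚ.+-suc r 1)) p))
             (-‿cong (trans (reflexive (≡.cong (x N) (≡.sym N≡))) (x-top N)))))) ⟩
    pow q (r ℕ.* r) * (w * 0# + pow q (suc r) * (0# - 1#))
      ≈⟨ solve 3 (λ a w b → a :* (w :* con (+ 0) :+ b :* (con (+ 0) :- con (+ 1))) := :- (a :* b)) refl _ _ _ ⟩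
    - (pow q (r ℕ.* r) * pow q (suc r)) ≈⟨ -‿cong (pow-+ q (r ℕ.* r) (suc r)) ⟨
    - pow q (r ℕ.* r ℕ.+ suc r) ≈⟨ -‿cong (pow-mod (r ℕ.* r ℕ.+ suc r) 3 1 r (index N≡)) ⟩
    - (pow q 2 * q) ≈⟨ solve 2 (λ q y → :- (y :* q) := q :* (:- y)) refl q (pow q 2) ⟩
    q * - pow q 2 ∎
    where
    w : Carrier
    w = pow q (suc (suc (suc (r ℕ.+ r))))
    N≡ : N ≡ suc (suc r)
    N≡ = ≡.trans (≡.sym p) (ℕₚ.+-comm r 2)
    index : ∀ {n} → n ≡ suc (suc r) → r ℕ.* r ℕ.+ suc r ℕ.+ 1 ℕ.* n ≡ 3 ℕ.+ r ℕ.* n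
    index ≡.refl = identity r
      where
      identity : ∀ r → r ℕ.* r ℕ.+ suc r ℕ.+ 1 ℕ.* suc (suc r) ≡ 3 ℕ.+ r ℕ.* suc (suc r)
      identity = solve-∀
  W-S (suc (suc (suc k))) r p = begin
    pow q (r ℕ.* r) * U r ≈⟨ *-congˡ (U-rec r) ⟩
    pow q (r ℕ.* r) * (w * U r₃ + pow q (suc r) * (x N (suc r) - x N (suc (suc r))))
      ≈⟨ *-congˡ (+-congˡ (*-congˡ (+-cong
           (x-N (suc r) (suc (suc k)) (s≤s z≤n) (s≤s z≤n) (≡.trans (≡.sym (ℕₚ.+-suc r (suc (suc k)))) p))
           (-‿cong (x-N (suc (suc r)) (suc k) (s≤s z≤n) (s≤s z≤n) (≡.trans (index₂ r k) p)))))) ⟩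
    pow q (r ℕ.* r) * (w * U r₃ + pow q (suc r) * (0# - 0#))
      ≈⟨ solve 4 (λ a w u b → a :* (w :* u :+ b :* (con (+ 0) :- con (+ 0))) := a :* w :* u) refl _ _ _ _ ⟩
    pow q (r ℕ.* r) * w * U r₃ ≈⟨ *-congʳ (trans (sym (pow-+ q (r ℕ.* r) (suc (suc (suc (r ℕ.+ r))))))
          (pow-mod (r ℕ.* r ℕ.+ suc (suc (suc (r ℕ.+ r)))) (4 ℕ.* k ℕ.+ 6 ℕ.+ r₃ ℕ.* r₃) 4 0 (index p))) ⟩
    pow q (4 ℕ.* k ℕ.+ 6 ℕ.+ r₃ ℕ.* r₃) * U r₃ ≈⟨ trans (*-congʳ (pow-+ q (4 ℕ.* k ℕ.+ 6) _)) (*-assoc _ _ _) ⟩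
    pow q (4 ℕ.* k ℕ.+ 6) * W r₃ ≈⟨ *-congˡ (W-S k r₃ (≡.trans (index₃ r k) p)) ⟩
    pow q (4 ℕ.* k ℕ.+ 6) * (q * S k) ≈⟨ solve 3 (λ a b d → a :* (b :* d) := b :* (a :* d)) refl _ _ _ ⟩
    q * S (suc (suc (suc k))) ∎
    where
    r₃ : ℕ
    r₃ = suc (suc (suc r))
    w : Carrier
    w = pow q (suc (suc (suc (r ℕ.+ r))))
    index₂ : ∀ r k → suc (suc r) ℕ.+ suc k ≡ r ℕ.+ suc (suc (suc k))
    index₂ = solve-∀
    index₃ : ∀ r k → suc (suc (suc r)) ℕ.+ k ≡ r ℕ.+ suc (suc (suc k))
    index₃ = solve-∀
    index : ∀ {n} → r ℕ.+ suc (suc (suc k)) ≡ n →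
      r ℕ.* r ℕ.+ suc (suc (suc (r ℕ.+ r))) ℕ.+ 4 ℕ.* n ≡ 4 ℕ.* k ℕ.+ 6 ℕ.+ r₃ ℕ.* r₃ ℕ.+ 0
    index ≡.refl = identity r k
      where
      identity : ∀ r k → r ℕ.* r ℕ.+ suc (suc (suc (r ℕ.+ r))) ℕ.+ 4 ℕ.* (r ℕ.+ suc (suc (suc k)))
        ≡ 4 ℕ.* k ℕ.+ 6 ℕ.+ suc (suc (suc r)) ℕ.* suc (suc (suc r)) ℕ.+ 0
      identity = solve-∀

  -- Vanishing of (q^(m+1))_m

  qpoch-zero : ∀ {n} d i → i < n → pow q (d ℕ.+ i) ≈ 1# → qpoch q (pow q d) n ≈ 0#
  qpoch-zero {suc n} d i i<n e with i ℕ.≟ n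
  ... | yes ≡.refl = trans (*-congˡ (trans (+-congˡ (-‿cong (trans (sym (pow-+ q d i)) e))) (-‿inverseʳ 1#))) (zeroʳ _)
  ... | no i≢n = trans (*-congʳ (qpoch-zero d i (ℕₚ.≤∧≢⇒< (ℕₚ.≤-pred i<n) i≢n) e)) (zeroˡ _)

  -- Among the exponents m + 1, ..., 2m there is a multiple of N. With m = ρ + t N the next one is
  -- (t + 1) N = m + 1 + i, and i < m follows from N ≤ 2m if t = 0 and from i < N ≤ m otherwise.
  P-zero : ∀ {m} → N ≤ m ℕ.+ m → P m ≈ 0#
  P-zero {m} N≤2m with m divMod N
    where instance _ = ℕ.>-nonZero 1≤N
  ... | result t ρ m≡ = qpoch-zero (suc m) i (i<m t m≡) (trans (pow-≡ q index) (pow-period (suc t)))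
    where
    i : ℕ
    i = N ∸ suc (Fin.toℕ ρ)
    ρ+i : suc (Fin.toℕ ρ) ℕ.+ i ≡ N
    ρ+i = ℕₚ.m+[n∸m]≡n (Finₚ.toℕ<n ρ)
    index : suc m ℕ.+ i ≡ suc t ℕ.* N
    index = ≡.trans (≡.cong (λ k → suc k ℕ.+ i) m≡) (≡.trans (identity (Fin.toℕ ρ) (t ℕ.* N) i) (≡.cong (ℕ._+ t ℕ.* N) ρ+i))
      where
      identity : ∀ a b i → suc (a ℕ.+ b) ℕ.+ i ≡ suc a ℕ.+ i ℕ.+ b
      identity = solve-∀
    i<m : ∀ t → m ≡ Fin.toℕ ρ ℕ.+ t ℕ.* N → i < m
    i<m zero e = ℕₚ.+-cancelˡ-≤ m (suc i) m (ℕₚ.≤-trans (ℕₚ.≤-reflexive (≡.trans (ℕₚ.+-suc m i)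
      (≡.trans (≡.cong (λ k → suc k ℕ.+ i) (≡.trans e (ℕₚ.+-identityʳ _))) ρ+i))) N≤2m)
    i<m (suc t) e = ℕₚ.<-≤-trans (ℕₚ.∸-monoʳ-< {N} {suc (Fin.toℕ ρ)} {0} (s≤s z≤n) (Finₚ.toℕ<n ρ))
      (≡.subst (N ≤_) (≡.sym e) (ℕₚ.≤-trans (ℕₚ.m≤m+n N (t ℕ.* N)) (ℕₚ.m≤n+m _ (Fin.toℕ ρ))))

  -- Closed forms of the partial sums of the α_k

  S-0 : ∀ t → S (t ℕ.* 3) ≈ 0#
  S-0 zero = refl
  S-0 (suc t) = trans (*-congˡ (S-0 t)) (zeroʳ _)

  S-1 : ∀ t → S (suc (t ℕ.* 3)) ≈ pow q (6 ℕ.* t ℕ.* t ℕ.+ 4 ℕ.* t)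
  S-1 zero = refl
  S-1 (suc t) = trans (*-congˡ (S-1 t)) (sym (pow-split q (4 ℕ.* suc (t ℕ.* 3) ℕ.+ 6) _ (identity t)))
    where
    identity : ∀ t → 6 ℕ.* suc t ℕ.* suc t ℕ.+ 4 ℕ.* suc t ≡ 4 ℕ.* suc (t ℕ.* 3) ℕ.+ 6 ℕ.+ (6 ℕ.* t ℕ.* t ℕ.+ 4 ℕ.* t)
    identity = solve-∀

  S-2 : ∀ t → S (suc (suc (t ℕ.* 3))) ≈ - pow q (6 ℕ.* t ℕ.* t ℕ.+ 8 ℕ.* t ℕ.+ 2)
  S-2 zero = refl
  S-2 (suc t) = trans (*-congˡ (S-2 t)) (trans (solve 2 (λ a b → a :* (:- b) := :- (a :* b)) refl _ _)
    (-‿cong (sym (pow-split q (4 ℕ.* suc (suc (t ℕ.* 3)) ℕ.+ 6) _ (identity t)))))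
    where
    identity : ∀ t → 6 ℕ.* suc t ℕ.* suc t ℕ.+ 8 ℕ.* suc t ℕ.+ 2
      ≡ 4 ℕ.* suc (suc (t ℕ.* 3)) ℕ.+ 6 ℕ.+ (6 ℕ.* t ℕ.* t ℕ.+ 8 ℕ.* t ℕ.+ 2)
    identity = solve-∀

  -- `alpha` is stuck until `k % 3` becomes a literal, so residue and quotient enter as equations to
  -- rewrite with.
  alpha-0 : ∀ k t → k ℕ.% 3 ≡ 0 → k ℕ./ 3 ≡ t → alpha q k ≡ pow q (6 ℕ.* t ℕ.* t ℕ.+ 4 ℕ.* t)
  alpha-0 k t e ≡.refl rewrite e = ≡.refl

  alpha-1 : ∀ k t → k ℕ.% 3 ≡ 1 → k ℕ./ 3 ≡ t →
    alpha q k ≡ - pow q (6 ℕ.* t ℕ.* t ℕ.+ 8 ℕ.* t ℕ.+ 2) - pow q (6 ℕ.* t ℕ.* t ℕ.+ 4 ℕ.* t)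
  alpha-1 k t e ≡.refl rewrite e = ≡.refl

  alpha-2 : ∀ k t → k ℕ.% 3 ≡ 2 → (k ℕ.+ 1) ℕ./ 3 ≡ t → alpha q k ≡ pow q (6 ℕ.* t ℕ.* t ∸ 4 ℕ.* t)
  alpha-2 k t e ≡.refl rewrite e = ≡.refl

  [i+t*3]/3 : ∀ i t → (i ℕ.+ t ℕ.* 3) ℕ./ 3 ≡ i ℕ./ 3 ℕ.+ t
  [i+t*3]/3 i t = ≡.trans (+-distrib-/-∣ʳ i (n∣m*n t)) (≡.cong (i ℕ./ 3 ℕ.+_) (m*n/n≡m t 3))

  -- `S` returns to zero at every multiple of 3. Thus α_k is a single monomial for k = 3t and k = 3t
  -- + 2, while for k = 3t + 1 both neighbouring partial sums contribute, which accounts for its two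
  -- terms.
  alpha-S : ∀ k → alpha q k ≈ S (suc k) - S k
  alpha-S k with k divMod 3
  ... | result t Fin.zero ≡.refl = begin
    alpha q (t ℕ.* 3) ≡⟨ alpha-0 (t ℕ.* 3) t ([m+kn]%n≡m%n 0 t 3) ([i+t*3]/3 0 t) ⟩
    pow q (6 ℕ.* t ℕ.* t ℕ.+ 4 ℕ.* t) ≈⟨ solve 1 (λ a → a := a :- con (+ 0)) refl _ ⟩
    pow q (6 ℕ.* t ℕ.* t ℕ.+ 4 ℕ.* t) - 0# ≈⟨ +-cong (S-1 t) (-‿cong (S-0 t)) ⟨
    S (suc (t ℕ.* 3)) - S (t ℕ.* 3) ∎
  ... | result t (Fin.suc Fin.zero) ≡.refl = begin
    alpha q (suc (t ℕ.* 3)) ≡⟨ alpha-1 (suc (t ℕ.* 3)) t ([m+kn]%n≡m%n 1 t 3) ([i+t*3]/3 1 t) ⟩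
    - pow q (6 ℕ.* t ℕ.* t ℕ.+ 8 ℕ.* t ℕ.+ 2) - pow q (6 ℕ.* t ℕ.* t ℕ.+ 4 ℕ.* t)
      ≈⟨ +-cong (S-2 t) (-‿cong (S-1 t)) ⟨
    S (suc (suc (t ℕ.* 3))) - S (suc (t ℕ.* 3)) ∎
  ... | result t (Fin.suc (Fin.suc Fin.zero)) ≡.refl = begin
    alpha q (suc (suc (t ℕ.* 3)))
      ≡⟨ alpha-2 (suc (suc (t ℕ.* 3))) (suc t) ([m+kn]%n≡m%n 2 t 3)
           (≡.trans (≡.cong (ℕ._/ 3) (ℕₚ.+-comm (suc (suc (t ℕ.* 3))) 1)) ([i+t*3]/3 3 t)) ⟩
    -- The subtraction is exact: 6(t+1)² - 4(t+1) = 6t² + 8t + 2.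
    pow q (6 ℕ.* suc t ℕ.* suc t ∸ 4 ℕ.* suc t)
      ≡⟨ ≡.cong (pow q) (≡.trans (≡.cong (_∸ 4 ℕ.* suc t) (identity t)) (ℕₚ.m+n∸n≡m (6 ℕ.* t ℕ.* t ℕ.+ 8 ℕ.* t ℕ.+ 2) (4 ℕ.* suc t))) ⟩
    pow q (6 ℕ.* t ℕ.* t ℕ.+ 8 ℕ.* t ℕ.+ 2) ≈⟨ solve 1 (λ a → a := con (+ 0) :- (:- a)) refl _ ⟩
    0# - - pow q (6 ℕ.* t ℕ.* t ℕ.+ 8 ℕ.* t ℕ.+ 2) ≈⟨ +-cong (S-0 (suc t)) (-‿cong (S-2 t)) ⟨
    S (suc (suc (suc (t ℕ.* 3)))) - S (suc (suc (t ℕ.* 3))) ∎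
    where
    identity : ∀ t → 6 ℕ.* suc t ℕ.* suc t ≡ 6 ℕ.* t ℕ.* t ℕ.+ 8 ℕ.* t ℕ.+ 2 ℕ.+ 4 ℕ.* suc t
    identity = solve-∀

  -- Signs, and comparison of the two sides

  sign-cong : ∀ k {y z} → y ≈ z → sign k y ≈ sign k z
  sign-cong zero e = e
  sign-cong (suc k) e = -‿cong (sign-cong k e)

  sign-* : ∀ k y z → sign k (y * z) ≈ sign k y * z
  sign-* zero y z = refl
  sign-* (suc k) y z = trans (-‿cong (sign-* k y z)) (solve 2 (λ a b → :- (a :* b) := (:- a) :* b) refl _ _)

  sign-h : ∀ k → sign k (pow q (suc k C 2)) ≈ h k
  sign-h zero = sym (*-identityˡ _)
  sign-h (suc k) = begin
    - sign k (pow q (suc (suc k) C 2)) ≈⟨ -‿cong (sign-cong k (pow-split q (suc k C 2) (suc k) binomial)) ⟩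
    - sign k (pow q (suc k C 2) * pow q (suc k)) ≈⟨ -‿cong (sign-* k _ _) ⟩
    - (sign k (pow q (suc k C 2)) * pow q (suc k)) ≈⟨ -‿cong (*-congʳ (sign-h k)) ⟩
    - (h k * pow q (suc k)) ≈⟨ solve 2 (λ a b → :- (a :* b) := (:- a) :* b) refl _ _ ⟩
    h (suc k) ∎
    where
    binomial : suc (suc k) C 2 ≡ (suc k C 2) ℕ.+ suc k
    binomial = ≡.trans (≡.sym (nCk+nC[k+1]≡[n+1]C[k+1] (suc k) 1))
      (≡.trans (≡.cong (ℕ._+ (suc k C 2)) (nC1≡n (suc k))) (ℕₚ.+-comm (suc k) (suc k C 2)))

  B-sum : ∀ r → sumBelow N (λ m → pow q⁻¹ (m ℕ.* m ℕ.+ m) * B m r) ≈ U r - pow q (suc (r ℕ.+ r)) * U (suc r)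
  B-sum r = begin
    sumBelow N (λ m → κ m * B m r)
      ≈⟨ sum-cong N (λ m _ → solve 4 (λ k a w b → k :* (a :- w :* b) := k :* a :+ (:- w) :* (k :* b)) refl _ _ _ _) ⟩
    sumBelow N (λ m → κ m * x m r + - w * (κ m * x m (suc r))) ≈⟨ sum-+ N _ _ ⟩
    U r + sumBelow N (λ m → - w * (κ m * x m (suc r))) ≈⟨ +-congˡ (sum-*ˡ N (- w) _) ⟩
    U r + - w * U (suc r) ≈⟨ solve 3 (λ u w v → u :+ (:- w) :* v := u :- w :* v) refl _ _ _ ⟩
    U r - w * U (suc r) ∎
    where
    w : Carrier
    w = pow q (suc (r ℕ.+ r))
    κ : ℕ → Carrier
    κ m = pow q⁻¹ (m ℕ.* m ℕ.+ m)

  -- One of the `suc j` factors q^(r²+r) is spent: q^r completes `s r` to the reflection-invariant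
  -- `h r`, and q^(r²) turns `U` into `W`. Only j factors remain, whence the p - 1 in the exponent.
  summand : ∀ j r k → suc (r ℕ.+ k) ≡ N →
    a (suc j) r * (U r - pow q (suc (r ℕ.+ r)) * U (suc r))
      ≈ q * sign k (pow q ((suc k C 2) ℕ.+ j ℕ.* (k ℕ.* k ℕ.+ k)) * alpha q k)
  summand j r k p = begin
    s r * (pow (μ r) j * μ r) * (U r - w * U (suc r))
      ≈⟨ *-congʳ (*-congˡ (*-congˡ (pow-+ q (r ℕ.* r) r))) ⟩
    s r * (pow (μ r) j * (pow q (r ℕ.* r) * pow q r)) * (U r - w * U (suc r))
      ≈⟨ solve 7 (λ s m y z u w v → s :* (m :* (y :* z)) :* (u :- w :* v) := s :* z :* m :* (y :* u :- y :* w :* v))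
           refl _ _ _ _ _ _ _ ⟩
    h r * pow (μ r) j * (W r - pow q (r ℕ.* r) * w * U (suc r))
      ≈⟨ *-congˡ (+-congˡ (-‿cong (*-congʳ (sym (pow-split q (r ℕ.* r) (suc (r ℕ.+ r)) (square r)))))) ⟩
    h r * pow (μ r) j * (W r - W (suc r))
      ≈⟨ *-cong (*-cong (h-reflect r k p) (trans (pow-cong j (μ-reflect r k p)) (sym (pow-* q (k ℕ.* k ℕ.+ k) j))))
           (+-cong (W-S (suc k) r (≡.trans (ℕₚ.+-suc r k) p)) (-‿cong (W-S k (suc r) p))) ⟩
    h k * v * (q * S (suc k) - q * S k)
      ≈⟨ solve 5 (λ h v q a b → h :* v :* (q :* a :- q :* b) := q :* (h :* (v :* (a :- b)))) refl _ _ _ _ _ ⟩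
    q * (h k * (v * (S (suc k) - S k))) ≈⟨ *-congˡ (*-cong (sym (sign-h k)) (*-congˡ (sym (alpha-S k)))) ⟩
    q * (sign k (pow q (suc k C 2)) * (v * alpha q k)) ≈⟨ *-congˡ (trans (sym (*-assoc _ _ _)) (*-congʳ (sym (sign-* k _ _)))) ⟩
    q * (sign k (pow q (suc k C 2) * v) * alpha q k) ≈⟨ *-congˡ (sign-* k _ _) ⟨
    q * sign k (pow q (suc k C 2) * v * alpha q k)
      ≈⟨ *-congˡ (sign-cong k (*-congʳ (pow-+ q (suc k C 2) _))) ⟨
    q * sign k (pow q ((suc k C 2) ℕ.+ j ℕ.* (k ℕ.* k ℕ.+ k)) * alpha q k) ∎
    where
    w v : Carrier
    w = pow q (suc (r ℕ.+ r))
    v = pow q (j ℕ.* (k ℕ.* k ℕ.+ k))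
    square : ∀ r → suc r ℕ.* suc r ≡ r ℕ.* r ℕ.+ suc (r ℕ.+ r)
    square = solve-∀

  H7-term : ∀ j m → m < N → P m * F q (suc j) m ≈ sumBelow N (λ r → a (suc j) r * B m r)
  H7-term j m m<N with ℕₚ.<-≤-connex (m ℕ.+ m) N
  ... | inj₁ 2m<N = F-expansion j 2m<N
  ... | inj₂ N≤2m = trans (*-congʳ (P-zero {m} N≤2m)) (trans (zeroˡ _) (sym (B-sum-vanishes m<N N≤2m (suc j))))

  H7≈RHS : ∀ j {M} → N ≤ M → H7 q q⁻¹ (suc j) M ≈ RHS q (suc j) N
  H7≈RHS j {M} N≤M = begin
    sumTo M (λ m → κ m * P m * F q (suc j) m) ≈⟨ sumTo≈sumBelow M _ ⟩
    sumBelow (suc M) (λ m → κ m * P m * F q (suc j) m)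
      -- Every m ≥ N satisfies N ≤ 2m, so `P-zero` removes the tail and the value does not depend on
      -- `M`.
      ≈⟨ sum-truncate _ (ℕₚ.≤-trans N≤M (ℕₚ.n≤1+n M))
           (λ m N≤m → trans (*-congʳ (trans (*-congˡ (P-zero {m} (ℕₚ.≤-trans N≤m (ℕₚ.m≤m+n m m)))) (zeroʳ _))) (zeroˡ _)) ⟩
    sumBelow N (λ m → κ m * P m * F q (suc j) m)
      ≈⟨ sum-cong N (λ m m<N → trans (*-assoc _ _ _) (trans (*-congˡ (H7-term j m m<N)) (sym (sum-*ˡ N _ _)))) ⟩
    sumBelow N (λ m → sumBelow N (λ r → κ m * (a (suc j) r * B m r))) ≈⟨ sum-swap N N _ ⟩
    sumBelow N (λ r → sumBelow N (λ m → κ m * (a (suc j) r * B m r)))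
      ≈⟨ sum-cong N (λ r _ → trans (sum-cong N (λ m _ → solve 3 (λ k a b → k :* (a :* b) := a :* (k :* b)) refl _ _ _))
           (trans (sum-*ˡ N _ _) (*-congˡ (B-sum r)))) ⟩
    sumBelow N (λ r → a (suc j) r * (U r - pow q (suc (r ℕ.+ r)) * U (suc r)))
      ≈⟨ sum-reverse N _ _ (summand j) ⟩
    sumBelow N (λ k → q * sign k (pow q ((suc k C 2) ℕ.+ j ℕ.* (k ℕ.* k ℕ.+ k)) * alpha q k)) ≈⟨ sum-*ˡ N q _ ⟩
    RHS q (suc j) N ∎
    where
    κ : ℕ → Carrier
    κ m = pow q⁻¹ (m ℕ.* m ℕ.+ m)

theorem2p8 : ∀ {c ℓ : Level} (R : CommutativeRing c ℓ) →
    let open CommutativeRing R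
        open Hseries R
    in (∀ a b → a * b ≈ 0# → a ≈ 0# ⊎ b ≈ 0#) →
       (∀ n → embed n ≈ 0# → n ≡ 0) →
       (p N : ℕ) → 1 ≤ p → 1 ≤ N →
       (q qinv : Carrier) → q * qinv ≈ 1# →
       pow q N ≈ 1# → (∀ k → 1 ≤ k → k < N → ¬ (pow q k ≈ 1#)) →
       (M : ℕ) → N ≤ M →
       H7 q qinv p M ≈ RHS q p N
theorem2p8 R domain char-zero (suc j) N _ 1≤N q qinv q*qinv≈1 q^N≈1 q^k≉1 M N≤M = RootOfUnity.H7≈RHS ζ j N≤M
  where
  ζ : PrimitiveRootOfUnity R
  ζ = record
    { no-zero-divisors = domain ; char-zero = char-zero ; N = N ; 1≤N = 1≤N ; q = q ; q⁻¹ = qinv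
    ; q*q⁻¹≈1 = q*qinv≈1 ; q^N≈1 = q^N≈1 ; q^k≉1 = q^k≉1 }
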